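{- Let $p$ be an odd prime, $a$ an odd integer not divisible by $p$, $m\ge 1$, and $N=4p^m$. Let $h$ be the size of the $(2a+p\mathbb{Z})$-monomial minimal solution of $(E_p)$. If $h\equiv 2\pmod 4$, then the $\overline{2a}$-monomial minimal solution of $(E_N)$ is reducible; if $h\equiv -1,0,1\pmod 4$, then the $\overline{2a}$-monomial minimal solution of $(E_N)$ is irreducible. In particular, $N$ is semi monomially irreducible if and only if for every odd integer $a$ not divisible by $p$, the size of the $(2a+p\mathbb{Z})$-monomial minimal solution of $(E_p)$ is not congruent to $2$ modulo $4$.
   Context: For an integer $N\ge 2$ and $a_1,\dots,a_n\in\mathbb{Z}/N\mathbb{Z}$, set $M_n(a_1,\dots,a_n)=\begin{pmatrix}a_n&-1\\1&0\end{pmatrix}\cdots\begin{pmatrix}a_1&-1\\1&0\end{pmatrix}\in SL_2(\mathbb{Z}/N\mathbb{Z})$. The equation $(E_N)$ is $M_n(a_1,\dots,a_n)=\pm \mathrm{Id}$; an $n$-tuple satisfying it is a solution of size $n$. Define $(a_1,\dots,a_n)\oplus(b_1,\dots,b_m)=(a_1+b_m,a_2,\dots,a_{n-1},a_n+b_1,b_2,\dots,b_{m-1})$, and $(a_1,\dots,a_n)\sim(b_1,\dots,b_n)$ if $(b_1,\dots,b_n)$ is a cyclic permutation of $(a_1,\dots,a_n)$ or of $(a_n,\dots,a_1)$. A solution $(c_1,\dots,c_n)$ of $(E_N)$ with $n\ge 3$ is reducible if there exist a solution $(b_1,\dots,b_l)$ of $(E_N)$ and an $m$-tuple $(a_1,\dots,a_m)$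 with $m\ge3$, $l\ge 3$ and $(c_1,\dots,c_n)\sim(a_1,\dots,a_m)\oplus(b_1,\dots,b_l)$; otherwise irreducible ($(\overline0,\overline0)$ is not irreducible). The $\overline k$-monomial minimal solution of $(E_N)$ is $(\overline k,\dots,\overline k)$ of the least positive length for which it solves $(E_N)$; its size is that length. Since $N=4p^m$ is divisible by $4$, $N$ is semi monomially irreducible if for every integer $a$ coprime to $N$ the $\overline{2a}$-monomial minimal solution of $(E_N)$ is irreducible. -}

module Defs where

open import Data.Nat as ℕ using (ℕ; zero; suc; _∸_; _≤_)
open import Data.Integer as ℤ using (ℤ; +_; -_; _+_; _*_; _-_; 1ℤ; 0ℤ)
open import Data.Integer.Divisibility using (_∣_)
open import Data.List using (List; []; _∷_; _++_; [_]; length; take; drop; reverse; replicate; foldr)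
open import Data.List.Relation.Binary.Pointwise using (Pointwise)
open import Data.Product using (_×_; Σ; ∃; _,_)
open import Data.Sum using (_⊎_)
open import Relation.Nullary using (¬_)

-- congruence modulo N in ℤ (elements of ℤ/Nℤ are represented by integers)
_≡_[mod_] : ℤ → ℤ → ℕ → Set
x ≡ y [mod N ] = (+ N) ∣ (x - y)

-- 2x2 matrices (entries (r11, r12, r21, r22))
record Mat : Set where
  constructor mat
  field
    m11 m12 m21 m22 : ℤ

_·_ : Mat → Mat → Mat
mat a b c d · mat e f g h = mat (a * e + b * g) (a * f + b * h) (c * e + d * g) (c * f + d * h)

IdM : Mat
IdM = mat 1ℤ 0ℤ 0ℤ 1ℤ

-- the matrix ( a  -1 ; 1  0 )
Mk : ℤ → Mat
Mk a = mat a (- 1ℤ) 1ℤ 0ℤ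

-- M (a₁ ∷ … ∷ aₙ) = Mk aₙ · … · Mk a₁
M : List ℤ → Mat
M [] = IdM
M (a ∷ as) = M as · Mk a

-- (E_N): M_n(a₁,…,aₙ) = ± Id in SL₂(ℤ/Nℤ)
Solution : ℕ → List ℤ → Set
Solution N c with M c
... | mat A B C D =
  (A ≡ 1ℤ [mod N ] × B ≡ 0ℤ [mod N ] × C ≡ 0ℤ [mod N ] × D ≡ 1ℤ [mod N ])
  ⊎ (A ≡ - 1ℤ [mod N ] × B ≡ 0ℤ [mod N ] × C ≡ 0ℤ [mod N ] × D ≡ - 1ℤ [mod N ])

-- helpers for ⊕ (only used on lists of length ≥ 3)
hd : List ℤ → ℤ
hd [] = 0ℤ
hd (x ∷ _) = x

lst : List ℤ → ℤ
lst [] = 0ℤ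
lst (x ∷ []) = x
lst (_ ∷ y ∷ ys) = lst (y ∷ ys)

-- (x₂, …, x_{n-1})
middle : List ℤ → List ℤ
middle xs = take (length xs ∸ 2) (drop 1 xs)

-- (a₁,…,aₙ) ⊕ (b₁,…,b_m) = (a₁+b_m, a₂,…,a_{n-1}, aₙ+b₁, b₂,…,b_{m-1})
_⊕_ : List ℤ → List ℤ → List ℤ
a ⊕ b = (hd a + lst b) ∷ middle a ++ ((lst a + hd b) ∷ middle b)

-- entrywise equality in ℤ/Nℤ
_≈[_]_ : List ℤ → ℕ → List ℤ → Set
c ≈[ N ] d = Pointwise (λ x y → x ≡ y [mod N ]) c d

rotate : ℕ → List ℤ → List ℤ
rotate k xs = drop k xs ++ take k xs

-- c ∼ d : d is a cyclic permutation of c or of the reverse of c (in ℤ/Nℤ)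
Equiv : ℕ → List ℤ → List ℤ → Set
Equiv N c d = ∃ λ k → (d ≈[ N ] rotate k c) ⊎ (d ≈[ N ] rotate k (reverse c))

Reducible : ℕ → List ℤ → Set
Reducible N c =
  Solution N c × 3 ≤ length c ×
  ∃ λ (a : List ℤ) → ∃ λ (b : List ℤ) →
    3 ≤ length a × 3 ≤ length b × Solution N b × Equiv N c (a ⊕ b)

Irreducible : ℕ → List ℤ → Set
Irreducible N c =
  Solution N c × 3 ≤ length c ×
  ¬ (∃ λ (a : List ℤ) → ∃ λ (b : List ℤ) →
       3 ≤ length a × 3 ≤ length b × Solution N b × Equiv N c (a ⊕ b))

-- h is the size of the k̄-monomial minimal solution of (E_N)
IsMonomialMinimalSize : ℕ → ℤ → ℕ → Set
IsMonomialMinimalSize N k h =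
  1 ≤ h × Solution N (replicate h k) ×
  (∀ n → 1 ≤ n → n ℕ.< h → ¬ Solution N (replicate n k))

-- N (divisible by 4) is semi monomially irreducible
SemiMonomiallyIrreducible : ℕ → Set
SemiMonomiallyIrreducible N =
  ∀ (a : ℤ) → Coprime' a → ∀ h → IsMonomialMinimalSize N (+ 2 * a) h →
    Irreducible N (replicate h (+ 2 * a))
  where
  open import Data.Nat.Coprimality using (Coprime)
  Coprime' : ℤ → Set
  Coprime' a = Coprime (ℤ.∣ a ∣) N

-- Put k = 2a and let ξ be a root of ξ² − kξ + 1. The matrix M_n(k, …, k) is the matrix of
-- multiplication by ξⁿ = U n · ξ − U (n − 1), so the monomial tuple of size n solves (E_N) exactly
-- when ξⁿ ≡ ±1 mod N. Modulo 4 we have k ≡ 2 and ξⁿ ≡ nξ + (1 − n); hence for N = 4pᵐ the tuple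
-- solves (E_N) iff 4 ∣ n and ξⁿ ≡ 1 mod pᵐ.
--
-- A decomposition (k, …, k) ∼ A ⊕ B forces B = (x, k, …, k, y), and the corner entry of M(B) gives
-- U (j + 1) ≡ ±1 mod N, where j is the number of middle entries of B; conversely such a j splits the
-- tuple as (k − U j, k, …, k, k − U j) ⊕ (U j, k, …, k, U j). As ξʲ has norm 1, U (j + 1) ≡ ±1 mod pᵐ
-- means ξʲ ≡ ±1 or ξʲ⁺² ≡ ∓1 mod pᵐ, and mod 4 it pins down j mod 4. So reducibility amounts to
-- ξ^(4w+2) ≡ −1 mod pᵐ for some w ≥ 1.
--
-- Let h be the least positive exponent with ξʰ ≡ ±1 mod p. Every exponent with ξⁱ ≡ ±1 mod p is a
-- multiple of h; if h is even then ξʰ ≡ −1 (an element of norm 1 squaring to 1 is ±1 when p is odd);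
-- and ξ^(p^(m−1) h) ≡ ξʰ mod pᵐ by the binomial theorem. Hence some ξ^(4w+2) ≡ −1 mod pᵐ exists
-- exactly when h ≡ 2 mod 4.

module Submission where

module MonomialSolutions where

  open import Algebra.Bundles using (CommutativeMonoid)
  import Algebra.Properties.CommutativeMonoid.Mult as MonoidPowers
  open import Data.Empty using (⊥)
  open import Data.Integer as ℤ using (ℤ; +_; -_; _+_; _*_; _-_; 1ℤ; 0ℤ; ∣_∣; _◃_)
  import Data.Integer.DivMod as ℤDM
  import Data.Integer.Divisibility as Unsigned
  open import Data.Integer.Divisibility.Signed
    using (_∣_; divides; ∣ᵤ⇒∣; ∣⇒∣ᵤ; _∣?_; ∣-trans; ∣m⇒∣-m; ∣m∣n⇒∣m+n; ∣n⇒∣m*n; ∣m⇒∣m*n)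
  import Data.Integer.Properties as ℤP
  open import Data.Integer.Tactic.RingSolver using (solve-∀; solve)
  open import Data.List using (List; _∷_; []; replicate; length; take; drop; reverse; _++_; [_]; _∷ʳ_)
  import Data.List.Properties as Listₚ
  open import Data.List.Relation.Binary.Pointwise as Pointwise using ()
  import Data.List.Relation.Binary.Pointwise.Properties as Pointwiseₚ
  open import Data.List.Relation.Unary.All as All using (All)
  import Data.List.Relation.Unary.All.Properties as Allₚ
  open import Data.Nat as ℕ using (ℕ; zero; suc; _≤_; _<_; z≤n; s≤s; _∸_)
  open import Data.Nat.Coprimality as Cop using (Coprime; coprime⇒gcd≡1; coprime-divisor; prime⇒coprime)
  import Data.Nat.Divisibility as ℕD
  open import Data.Nat.Divisibility using (divides)
  import Data.Nat.DivMod as ℕDM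
  open import Data.Nat.LCM using (lcm; lcm-least; gcd*lcm)
  open import Data.Nat.Primality using (Prime; euclidsLemma; prime⇒irreducible; prime⇒nonTrivial; prime[2])
  import Data.Nat.Properties as ℕP
  import Data.Nat.Tactic.RingSolver as ℕS
  open import Data.Product as Product using (_×_; _,_; proj₁; proj₂; Σ; ∃)
  open import Data.Sign as Sign using (Sign)
  import Data.Sign.Properties as Signₚ
  open import Data.Sum as Sum using (_⊎_; inj₁; inj₂)
  open import Function using (_∘_)
  open import Level using (0ℓ)
  open import Relation.Binary.Bundles using (Setoid)
  open import Relation.Binary.Definitions using (Tri; tri<; tri≈; tri>)
  open import Relation.Binary.PropositionalEquality hiding ([_])
  import Relation.Binary.Reasoning.Setoid as SetoidReasoning
  open import Relation.Nullary using (¬_; Dec; yes; no; contradiction)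
  open import Relation.Nullary.Decidable as Dec using (_×-dec_)
  open import Defs using (_≡_[mod_]; Mat; mat; _·_; IdM; Mk; M; Solution; IsMonomialMinimalSize;
    Reducible; Irreducible; hd; lst; middle; rotate; Equiv; _≈[_]_; _⊕_)

  -- Congruences modulo n

  -- A record, unlike Defs._≡_[mod_], lets Agda infer x, y and n from a proof.
  infix 4 _≡_⟨mod_⟩
  record _≡_⟨mod_⟩ (x y : ℤ) (n : ℕ) : Set where
    constructor congruent
    field divides-difference : + n ∣ x - y

  mod-via : ∀ {n x y z} → + n ∣ z → z ≡ x - y → x ≡ y ⟨mod n ⟩
  mod-via n∣z refl = congruent n∣z

  mod-refl : ∀ {n x} → x ≡ x ⟨mod n ⟩
  mod-refl {x = x} = mod-via (divides 0ℤ refl) (sym (ℤP.+-inverseʳ x))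

  mod-reflexive : ∀ {n x y} → x ≡ y → x ≡ y ⟨mod n ⟩
  mod-reflexive refl = mod-refl

  mod-sym : ∀ {n x y} → x ≡ y ⟨mod n ⟩ → y ≡ x ⟨mod n ⟩
  mod-sym {x = x} {y} (congruent d) = mod-via (∣m⇒∣-m d) (solve (x ∷ y ∷ []))

  mod-trans : ∀ {n x y z} → x ≡ y ⟨mod n ⟩ → y ≡ z ⟨mod n ⟩ → x ≡ z ⟨mod n ⟩
  mod-trans {x = x} {y} {z} (congruent d) (congruent e) =
    mod-via (∣m∣n⇒∣m+n d e) (solve (x ∷ y ∷ z ∷ []))

  mod-+ : ∀ {n x x′ y y′} → x ≡ x′ ⟨mod n ⟩ → y ≡ y′ ⟨mod n ⟩ → x + y ≡ x′ + y′ ⟨mod n ⟩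
  mod-+ {x = x} {x′} {y} {y′} (congruent d) (congruent e) =
    mod-via (∣m∣n⇒∣m+n d e) (solve (x ∷ x′ ∷ y ∷ y′ ∷ []))

  mod-neg : ∀ {n x x′} → x ≡ x′ ⟨mod n ⟩ → - x ≡ - x′ ⟨mod n ⟩
  mod-neg {x = x} {x′} (congruent d) = mod-via (∣m⇒∣-m d) (solve (x ∷ x′ ∷ []))

  mod-- : ∀ {n x x′ y y′} → x ≡ x′ ⟨mod n ⟩ → y ≡ y′ ⟨mod n ⟩ → x - y ≡ x′ - y′ ⟨mod n ⟩
  mod-- c d = mod-+ c (mod-neg d)

  mod-* : ∀ {n x x′ y y′} → x ≡ x′ ⟨mod n ⟩ → y ≡ y′ ⟨mod n ⟩ → x * y ≡ x′ * y′ ⟨mod n ⟩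
  mod-* {x = x} {x′} {y} {y′} (congruent d) (congruent e) =
    mod-via (∣m∣n⇒∣m+n (∣n⇒∣m*n x e) (∣m⇒∣m*n y′ d)) (solve (x ∷ x′ ∷ y ∷ y′ ∷ []))

  mod-*ˡ : ∀ {n y y′} x → y ≡ y′ ⟨mod n ⟩ → x * y ≡ x * y′ ⟨mod n ⟩
  mod-*ˡ x = mod-* (mod-refl {x = x})

  mod-*ʳ : ∀ {n x x′} y → x ≡ x′ ⟨mod n ⟩ → x * y ≡ x′ * y ⟨mod n ⟩
  mod-*ʳ y c = mod-* c (mod-refl {x = y})

  mod-≡0⇒ : ∀ {n x y} → x - y ≡ 0ℤ ⟨mod n ⟩ → x ≡ y ⟨mod n ⟩
  mod-≡0⇒ {x = x} {y} (congruent d) = mod-via d (ℤP.+-identityʳ (x - y))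

  mod-⇒≡0 : ∀ {n x y} → x ≡ y ⟨mod n ⟩ → x - y ≡ 0ℤ ⟨mod n ⟩
  mod-⇒≡0 {x = x} {y} (congruent d) = mod-via d (sym (ℤP.+-identityʳ (x - y)))

  mod-multiple : ∀ {n} t → + n * t ≡ 0ℤ ⟨mod n ⟩
  mod-multiple {n} t = mod-via (divides t (ℤP.*-comm (+ n) t)) (sym (ℤP.+-identityʳ (+ n * t)))

  mod-+-multiple : ∀ {m} x t → x + t * + m ≡ x ⟨mod m ⟩
  mod-+-multiple {m} x t = mod-via (divides t refl) (sym (cancel x (t * + m)))
    where
    cancel : ∀ x y → x + y - x ≡ y
    cancel = solve-∀

  mod-∣ : ∀ {d n x y} → d ℕD.∣ n → x ≡ y ⟨mod n ⟩ → x ≡ y ⟨mod d ⟩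
  mod-∣ d∣n (congruent e) = congruent (∣-trans (∣ᵤ⇒∣ d∣n) e)

  ≡[mod]⇒≡⟨mod⟩ : ∀ {n x y} → x ≡ y [mod n ] → x ≡ y ⟨mod n ⟩
  ≡[mod]⇒≡⟨mod⟩ d = congruent (∣ᵤ⇒∣ d)

  ≡⟨mod⟩⇒≡[mod] : ∀ {n x y} → x ≡ y ⟨mod n ⟩ → x ≡ y [mod n ]
  ≡⟨mod⟩⇒≡[mod] (congruent d) = ∣⇒∣ᵤ d

  mod-≡0⇒∣ : ∀ {n x} → x ≡ 0ℤ ⟨mod n ⟩ → n ℕD.∣ ∣ x ∣
  mod-≡0⇒∣ {x = x} c = subst (λ z → _ ℕD.∣ ∣ z ∣) (ℤP.+-identityʳ x) (≡⟨mod⟩⇒≡[mod] c)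

  ∣⇒mod-≡0 : ∀ {n x} → n ℕD.∣ ∣ x ∣ → x ≡ 0ℤ ⟨mod n ⟩
  ∣⇒mod-≡0 {x = x} d = ≡[mod]⇒≡⟨mod⟩ (subst (λ z → _ ℕD.∣ ∣ z ∣) (sym (ℤP.+-identityʳ x)) d)

  _≡?_⟨mod_⟩ : ∀ x y n → Dec (x ≡ y ⟨mod n ⟩)
  x ≡? y ⟨mod n ⟩ = Dec.map′ congruent _≡_⟨mod_⟩.divides-difference (+ n ∣? x - y)

  coprime⇒*∣ : ∀ {m n d} → Coprime m n → m ℕD.∣ d → n ℕD.∣ d → m ℕ.* n ℕD.∣ d
  coprime⇒*∣ {m} {n} c m∣d n∣d = subst (ℕD._∣ _) lcm≡* (lcm-least m∣d n∣d)
    where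
    lcm≡* : lcm m n ≡ m ℕ.* n
    lcm≡* = trans (sym (ℕP.*-identityˡ (lcm m n)))
                  (trans (cong (ℕ._* lcm m n) (sym (coprime⇒gcd≡1 c))) (gcd*lcm m n))

  mod-crt : ∀ {m n x y} → Coprime m n → x ≡ y ⟨mod m ⟩ → x ≡ y ⟨mod n ⟩ → x ≡ y ⟨mod m ℕ.* n ⟩
  mod-crt c a b = ≡[mod]⇒≡⟨mod⟩ (coprime⇒*∣ c (≡⟨mod⟩⇒≡[mod] a) (≡⟨mod⟩⇒≡[mod] b))

  1≢-1⟨mod_⟩ : ∀ {n} → 3 ≤ n → ¬ 1ℤ ≡ - 1ℤ ⟨mod n ⟩
  1≢-1⟨mod_⟩ n≥3 c = ℕP.<-irrefl refl (ℕP.≤-trans n≥3 (ℕD.∣⇒≤ (≡⟨mod⟩⇒≡[mod] c)))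

  mod-setoid : ℕ → Setoid 0ℓ 0ℓ
  mod-setoid n = record
    { Carrier = ℤ
    ; _≈_ = _≡_⟨mod n ⟩
    ; isEquivalence = record { refl = mod-refl ; sym = mod-sym ; trans = mod-trans }
    }

  module mod-Reasoning (n : ℕ) = SetoidReasoning (mod-setoid n)

  -- Natural numbers and primes

  least : ∀ {P : ℕ → Set} → (∀ n → Dec (P n)) → ∀ {n} → P n → ∃ λ m → P m × ∀ {i} → i < m → ¬ P i
  least P? {zero} p = 0 , p , λ ()
  least P? {suc n} p with P? 0
  ... | yes p₀ = 0 , p₀ , λ ()
  ... | no ¬p₀ with least (λ i → P? (suc i)) {n} p
  ...   | m , pₘ , below = suc m , pₘ , λ { {zero} _ → ¬p₀ ; {suc i} (s≤s i<m) → below i<m }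

  coprime-*ʳ : ∀ {x m n} → Coprime x m → Coprime x n → Coprime x (m ℕ.* n)
  coprime-*ʳ {x} {m} cm cn {d} (d∣x , d∣mn) = cn (d∣x , coprime-divisor d⊥m d∣mn)
    where
    d⊥m : Coprime d m
    d⊥m (e∣d , e∣m) = cm (ℕD.∣-trans e∣d d∣x , e∣m)

  coprime-^ʳ : ∀ {x m} r → Coprime x m → Coprime x (m ℕ.^ r)
  coprime-^ʳ zero c (_ , d∣1) = ℕD.∣1⇒≡1 d∣1
  coprime-^ʳ (suc r) c = coprime-*ʳ c (coprime-^ʳ r c)

  prime∤⇒coprime : ∀ {p x} → Prime p → ¬ p ℕD.∣ x → Coprime p x
  prime∤⇒coprime pr p∤x (d∣p , d∣x) with prime⇒irreducible pr d∣p
  ... | inj₁ d≡1 = d≡1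
  ... | inj₂ refl = contradiction d∣x p∤x

  mod-euclid : ∀ {p x y} → Prime p → x * y ≡ 0ℤ ⟨mod p ⟩ → x ≡ 0ℤ ⟨mod p ⟩ ⊎ y ≡ 0ℤ ⟨mod p ⟩
  mod-euclid {x = x} {y} pr c =
    Sum.map ∣⇒mod-≡0 ∣⇒mod-≡0 (euclidsLemma ∣ x ∣ ∣ y ∣ pr (subst (_ ℕD.∣_) (ℤP.abs-* x y) (mod-≡0⇒∣ c)))

  mod-cancel-prime-power : ∀ {p x y} m → Prime p → ¬ x ≡ 0ℤ ⟨mod p ⟩ →
                           x * y ≡ 0ℤ ⟨mod p ℕ.^ m ⟩ → y ≡ 0ℤ ⟨mod p ℕ.^ m ⟩
  mod-cancel-prime-power {x = x} {y} m pr x≢0 c = ∣⇒mod-≡0 (coprime-divisor pᵐ⊥x pᵐ∣xy)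
    where
    pᵐ⊥x : Coprime (_ ℕ.^ m) ∣ x ∣
    pᵐ⊥x = Cop.sym (coprime-^ʳ m (Cop.sym (prime∤⇒coprime pr (x≢0 ∘ ∣⇒mod-≡0))))
    pᵐ∣xy : _ ℕ.^ m ℕD.∣ ∣ x ∣ ℕ.* ∣ y ∣
    pᵐ∣xy = subst (_ ℕD.∣_) (ℤP.abs-* x y) (mod-≡0⇒∣ c)

  mod-prime-power-roots : ∀ {p x y} m → Prime p → ¬ y ≡ 0ℤ ⟨mod p ⟩ → x * (x - y) ≡ 0ℤ ⟨mod p ℕ.^ m ⟩ →
                          x ≡ 0ℤ ⟨mod p ℕ.^ m ⟩ ⊎ x ≡ y ⟨mod p ℕ.^ m ⟩
  mod-prime-power-roots {p} {x} {y} m pr y≢0 c with x ≡? 0ℤ ⟨mod p ⟩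
  ... | yes x≡0 = inj₁ (mod-cancel-prime-power m pr x-y≢0 (mod-trans (mod-reflexive (ℤP.*-comm (x - y) x)) c))
    where
    x-y≢0 : ¬ x - y ≡ 0ℤ ⟨mod p ⟩
    x-y≢0 x-y≡0 = y≢0 (mod-trans (mod-reflexive (sym (cancel x y))) (mod-- x≡0 x-y≡0))
      where
      cancel : ∀ x y → x - (x - y) ≡ y
      cancel = solve-∀
  ... | no x≢0 = inj₂ (mod-≡0⇒ (mod-cancel-prime-power m pr x≢0 c))

  odd-prime≥3 : ∀ {p} → Prime p → p ≢ 2 → 3 ≤ p
  odd-prime≥3 {p} pr p≢2 = ℕP.≤∧≢⇒< (ℕ.nonTrivial⇒n>1 p {{prime⇒nonTrivial pr}}) (p≢2 ∘ sym)

  odd-prime∤8 : ∀ {p} → Prime p → 3 ≤ p → ¬ + 8 ≡ 0ℤ ⟨mod p ⟩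
  odd-prime∤8 pr p≥3 8≡0 =
    ℕP.<-irrefl (sym (coprime-^ʳ 3 (prime⇒coprime pr p≥3) (ℕD.∣-refl , mod-≡0⇒∣ 8≡0))) (ℕP.≤-trans (ℕP.n≤1+n 2) p≥3)

  odd-prime-odd : ∀ {p} → Prime p → 3 ≤ p → ∃ λ t → p ≡ suc (t ℕ.* 2)
  odd-prime-odd {p} pr p≥3 with p ℕ.% 2 | ℕDM.m≡m%n+[m/n]*n p 2 | ℕDM.m%n<n p 2
  ... | 0 | p≡ | _ = contradiction (prime⇒coprime pr p≥3 (divides (p ℕ./ 2) p≡ , ℕD.∣-refl)) λ ()
  ... | 1 | p≡ | _ = p ℕ./ 2 , p≡
  ... | suc (suc _) | _ | s≤s (s≤s ())

  residue≡2⇒ : ∀ h → h ℕ.% 4 ≡ 2 → h ≡ 2 ℕ.+ h ℕ./ 4 ℕ.* 4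
  residue≡2⇒ h h%4≡2 = trans (ℕDM.m≡m%n+[m/n]*n h 4) (cong (ℕ._+ h ℕ./ 4 ℕ.* 4) h%4≡2)

  odd-residue⇒¬2∣ : ∀ h {r} → h ℕ.% 4 ≡ r → r ℕ.% 2 ≡ 1 → ¬ 2 ℕD.∣ h
  odd-residue⇒¬2∣ h {r} h%4≡r r%2≡1 2∣h = contradiction 1≡0 λ ()
    where
    1≡0 : 1 ≡ 0
    1≡0 = trans (sym r%2≡1) (trans (cong (ℕ._% 2) (sym h%4≡r))
                (trans (ℕDM.m∣n⇒o%n%m≡o%m 2 4 h (divides 2 refl)) (ℕD.n∣m⇒m%n≡0 h 2 2∣h)))

  residue≢2⇒odd⊎4∣ : ∀ h → h ℕ.% 4 ≡ 3 ⊎ h ℕ.% 4 ≡ 0 ⊎ h ℕ.% 4 ≡ 1 → ¬ 2 ℕD.∣ h ⊎ 4 ℕD.∣ h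
  residue≢2⇒odd⊎4∣ h (inj₁ h%4≡3) = inj₁ (odd-residue⇒¬2∣ h h%4≡3 refl)
  residue≢2⇒odd⊎4∣ h (inj₂ (inj₁ h%4≡0)) = inj₂ (ℕD.m%n≡0⇒n∣m h 4 h%4≡0)
  residue≢2⇒odd⊎4∣ h (inj₂ (inj₂ h%4≡1)) = inj₁ (odd-residue⇒¬2∣ h h%4≡1 refl)

  residue≢2-cases : ∀ h → h ℕ.% 4 ≢ 2 → h ℕ.% 4 ≡ 3 ⊎ h ℕ.% 4 ≡ 0 ⊎ h ℕ.% 4 ≡ 1
  residue≢2-cases h ≢2 with h ℕ.% 4 | ℕDM.m%n<n h 4
  ... | 0 | _ = inj₂ (inj₁ refl)
  ... | 1 | _ = inj₂ (inj₂ refl)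
  ... | 2 | _ = contradiction refl ≢2
  ... | 3 | _ = inj₁ refl
  ... | suc (suc (suc (suc _))) | s≤s (s≤s (s≤s (s≤s ())))

  4∤2 : ¬ 4 ℕD.∣ 2
  4∤2 4∣2 with ℕD.∣⇒≤ 4∣2
  ... | s≤s (s≤s ())

  coprime-4pᵐ : ∀ {p a} m → Prime p → ¬ + 2 Unsigned.∣ a → ¬ + p Unsigned.∣ a → Coprime ∣ a ∣ (4 ℕ.* p ℕ.^ m)
  coprime-4pᵐ m pr a-odd p∤a = coprime-*ʳ (coprime-^ʳ 2 (Cop.sym (prime∤⇒coprime prime[2] a-odd)))
                                          (coprime-^ʳ m (Cop.sym (prime∤⇒coprime pr p∤a)))

  coprime-4pᵐ⁻¹ : ∀ {p a} m → 3 ≤ p → Coprime ∣ a ∣ (4 ℕ.* p ℕ.^ suc m) → ¬ + 2 Unsigned.∣ a × ¬ + p Unsigned.∣ a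
  coprime-4pᵐ⁻¹ {p} m p≥3 a⊥N =
    (λ 2∣a → contradiction (a⊥N (2∣a , ℕD.∣-trans (divides 2 refl) (ℕD.m∣m*n (p ℕ.^ suc m)))) λ ()) ,
    (λ p∣a → ℕP.<-irrefl (sym (a⊥N (p∣a , ℕD.∣n⇒∣m*n 4 (ℕD.m∣m*n (p ℕ.^ m))))) (ℕP.≤-trans (ℕP.n≤1+n 2) p≥3))

  -- Signs ±1

  ⟦_⟧ : Sign → ℤ
  ⟦ s ⟧ = s ◃ 1

  ⟦⟧-* : ∀ s t → ⟦ s Sign.* t ⟧ ≡ ⟦ s ⟧ * ⟦ t ⟧
  ⟦⟧-* Sign.+ Sign.+ = refl
  ⟦⟧-* Sign.+ Sign.- = refl
  ⟦⟧-* Sign.- Sign.+ = refl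
  ⟦⟧-* Sign.- Sign.- = refl

  ⟦⟧-square : ∀ s → ⟦ s ⟧ * ⟦ s ⟧ ≡ 1ℤ
  ⟦⟧-square Sign.+ = refl
  ⟦⟧-square Sign.- = refl

  ⟦⟧-injective-mod : ∀ {n s t} → 3 ≤ n → ⟦ s ⟧ ≡ ⟦ t ⟧ ⟨mod n ⟩ → s ≡ t
  ⟦⟧-injective-mod {s = Sign.+} {Sign.+} n≥3 c = refl
  ⟦⟧-injective-mod {s = Sign.+} {Sign.-} n≥3 c = contradiction c (1≢-1⟨mod n≥3 ⟩)
  ⟦⟧-injective-mod {s = Sign.-} {Sign.+} n≥3 c = contradiction (mod-sym c) (1≢-1⟨mod n≥3 ⟩)
  ⟦⟧-injective-mod {s = Sign.-} {Sign.-} n≥3 c = refl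

  *≡+⇒≡ : ∀ {s t} → s Sign.* t ≡ Sign.+ → t ≡ s
  *≡+⇒≡ {Sign.+} {Sign.+} _ = refl
  *≡+⇒≡ {Sign.-} {Sign.-} _ = refl

  ⟦⟧-opposite : ∀ s → - ⟦ s ⟧ ≡ ⟦ Sign.- Sign.* s ⟧
  ⟦⟧-opposite Sign.+ = refl
  ⟦⟧-opposite Sign.- = refl

  infixr 8 _^ˢ_
  _^ˢ_ : Sign → ℕ → Sign
  s ^ˢ zero = Sign.+
  s ^ˢ suc r = s Sign.* s ^ˢ r

  ^ˢ-even : ∀ s t → s ^ˢ (t ℕ.* 2) ≡ Sign.+
  ^ˢ-even s zero = refl
  ^ˢ-even s (suc t) = begin
    s Sign.* (s Sign.* s ^ˢ (t ℕ.* 2)) ≡⟨ Signₚ.*-assoc s s _ ⟨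
    (s Sign.* s) Sign.* s ^ˢ (t ℕ.* 2) ≡⟨ cong (Sign._* s ^ˢ (t ℕ.* 2)) (Signₚ.s*s≡+ s) ⟩
    s ^ˢ (t ℕ.* 2)                     ≡⟨ ^ˢ-even s t ⟩
    Sign.+                             ∎
    where open ≡-Reasoning

  ^ˢ-odd : ∀ s t → s ^ˢ suc (t ℕ.* 2) ≡ s
  ^ˢ-odd s t = trans (cong (s Sign.*_) (^ˢ-even s t)) (Signₚ.*-identityʳ s)

  ^ˢ-odd⁻¹ : ∀ r → Sign.- ≡ Sign.- ^ˢ r → ∃ λ t → r ≡ suc (t ℕ.* 2)
  ^ˢ-odd⁻¹ zero ()
  ^ˢ-odd⁻¹ (suc zero) _ = 0 , refl
  ^ˢ-odd⁻¹ (suc (suc r)) eq =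
    Product.map suc (cong (suc ∘ suc)) (^ˢ-odd⁻¹ r (trans eq (Signₚ.opposite-involutive (Sign.- ^ˢ r))))

  ^ˢ-odd-prime : ∀ {p} → Prime p → 3 ≤ p → ∀ s → s ^ˢ p ≡ s
  ^ˢ-odd-prime pr p≥3 s with odd-prime-odd pr p≥3
  ... | t , refl = ^ˢ-odd s t

  -- Lists and 2 × 2 matrices

  lst-snoc : ∀ (y : ℤ) xs z → lst (y ∷ xs ++ [ z ]) ≡ z
  lst-snoc y [] z = refl
  lst-snoc y (x ∷ xs) z = lst-snoc x xs z

  length-snoc : ∀ (y : ℤ) xs z → length (y ∷ xs ++ [ z ]) ≡ suc (suc (length xs))
  length-snoc y xs z = cong suc (trans (Listₚ.length-++ xs) (ℕP.+-comm (length xs) 1))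

  middle-snoc : ∀ (y : ℤ) xs z → middle (y ∷ xs ++ [ z ]) ≡ xs
  middle-snoc y xs z = trans (cong (λ n → take (n ∸ 2) (xs ++ [ z ])) (length-snoc y xs z)) (take-snoc xs)
    where
    take-snoc : ∀ xs → take (length xs) (xs ++ [ z ]) ≡ xs
    take-snoc [] = refl
    take-snoc (x ∷ xs) = cong (x ∷_) (take-snoc xs)

  hd∷middle∷lst : ∀ l → 2 ≤ length l → l ≡ hd l ∷ middle l ++ [ lst l ]
  hd∷middle∷lst (y ∷ []) (s≤s ())
  hd∷middle∷lst (y ∷ z ∷ zs) _ = cong (y ∷_) (init∷lst z zs)
    where
    init∷lst : ∀ z zs → z ∷ zs ≡ take (length zs) (z ∷ zs) ++ [ lst (z ∷ zs) ]
    init∷lst z [] = refl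
    init∷lst z (w ∷ ws) = cong (z ∷_) (init∷lst w ws)

  1≤length-middle : ∀ l → 3 ≤ length l → 1 ≤ length (middle l)
  1≤length-middle l 3≤l = ℕP.≤-pred (ℕP.≤-pred (subst (3 ≤_) length≡ 3≤l))
    where
    length≡ : length l ≡ suc (suc (length (middle l)))
    length≡ = trans (cong length (hd∷middle∷lst l (ℕP.≤-trans (ℕP.n≤1+n 2) 3≤l)))
                    (length-snoc (hd l) (middle l) (lst l))

  length-rotate : ∀ r (l : List ℤ) → length (rotate r l) ≡ length l
  length-rotate r l = trans (Listₚ.length-++-comm (drop r l) (take r l)) (cong length (Listₚ.take++drop≡id r l))

  reverse-replicate : ∀ n (x : ℤ) → reverse (replicate n x) ≡ replicate n x
  reverse-replicate zero x = refl
  reverse-replicate (suc n) x =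
    trans (Listₚ.unfold-reverse x (replicate n x)) (trans (cong (_∷ʳ x) (reverse-replicate n x)) (snoc n))
    where
    snoc : ∀ n → replicate n x ∷ʳ x ≡ x ∷ replicate n x
    snoc zero = refl
    snoc (suc n) = cong (x ∷_) (snoc n)

  Equiv-replicate⇒All : ∀ {N h k d} → Equiv N (replicate h k) d →
                        All (_≡ k ⟨mod N ⟩) d × length d ≡ h
  Equiv-replicate⇒All {N} {h} {k} (r , inj₁ d≈) =
    All-≡k d≈ (rotated (replicate h k) (Allₚ.replicate⁺ h refl)) ,
    trans (Pointwiseₚ.Pointwise-length d≈) (trans (length-rotate r (replicate h k)) (Listₚ.length-replicate h))
    where
    rotated : ∀ l → All (_≡ k) l → All (_≡ k) (rotate r l)
    rotated l all = Allₚ.++⁺ (Allₚ.drop⁺ r all) (Allₚ.take⁺ r all)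
    All-≡k : ∀ {d e} → d ≈[ N ] e → All (_≡ k) e → All (_≡ k ⟨mod N ⟩) d
    All-≡k Pointwise.[] All.[] = All.[]
    All-≡k (x≈y Pointwise.∷ d≈e) (refl All.∷ all) = ≡[mod]⇒≡⟨mod⟩ x≈y All.∷ All-≡k d≈e all
  Equiv-replicate⇒All {N} {h} {k} (r , inj₂ d≈) =
    Equiv-replicate⇒All (r , inj₁ (subst (λ l → _ ≈[ N ] rotate r l) (reverse-replicate h k) d≈))

  All≡⇒≈replicate : ∀ {N x} d → All (_≡ x ⟨mod N ⟩) d → d ≈[ N ] replicate (length d) x
  All≡⇒≈replicate [] All.[] = Pointwise.[]
  All≡⇒≈replicate (y ∷ d) (y≡x All.∷ all) = ≡⟨mod⟩⇒≡[mod] y≡x Pointwise.∷ All≡⇒≈replicate d all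

  mat-cong : ∀ {a b c d a′ b′ c′ d′} → a ≡ a′ → b ≡ b′ → c ≡ c′ → d ≡ d′ → mat a b c d ≡ mat a′ b′ c′ d′
  mat-cong refl refl refl refl = refl

  ·-assoc : ∀ X Y Z → (X · Y) · Z ≡ X · (Y · Z)
  ·-assoc (mat a b c d) (mat e f g h) (mat i j k l) =
    mat-cong (entry a b e g i k f h) (entry a b e g j l f h) (entry c d e g i k f h) (entry c d e g j l f h)
    where
    entry : ∀ a b e g i k f h → (a * e + b * g) * i + (a * f + b * h) * k ≡ a * (e * i + f * k) + b * (g * i + h * k)
    entry = solve-∀

  ·-identityˡ : ∀ X → IdM · X ≡ X
  ·-identityˡ (mat a b c d) = mat-cong (top a c) (top b d) (bottom a c) (bottom b d)
    where
    top : ∀ a c → 1ℤ * a + 0ℤ * c ≡ a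
    top = solve-∀
    bottom : ∀ a c → 0ℤ * a + 1ℤ * c ≡ c
    bottom = solve-∀

  ·-identityʳ : ∀ X → X · IdM ≡ X
  ·-identityʳ (mat a b c d) = mat-cong (left a b) (right a b) (left c d) (right c d)
    where
    left : ∀ a b → a * 1ℤ + b * 0ℤ ≡ a
    left = solve-∀
    right : ∀ a b → a * 0ℤ + b * 1ℤ ≡ b
    right = solve-∀

  M-snoc : ∀ xs y → M (xs ++ [ y ]) ≡ Mk y · M xs
  M-snoc [] y = trans (·-identityˡ (Mk y)) (sym (·-identityʳ (Mk y)))
  M-snoc (x ∷ xs) y = trans (cong (_· Mk x) (M-snoc xs y)) (·-assoc (Mk y) (M xs) (Mk x))

  M-bracket-m₂₂ : ∀ x ms y → Mat.m22 (M (x ∷ ms ++ [ y ])) ≡ - Mat.m11 (M ms)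
  M-bracket-m₂₂ x ms y = trans (cong (λ X → Mat.m22 (X · Mk x)) (M-snoc ms y)) (corner (M ms))
    where
    corner : ∀ X → Mat.m22 ((Mk y · X) · Mk x) ≡ - Mat.m11 X
    corner (mat a b c d) = entry a b c d
      where
      entry : ∀ a b c d → (1ℤ * a + 0ℤ * c) * - 1ℤ + (1ℤ * b + 0ℤ * d) * 0ℤ ≡ - a
      entry = solve-∀

  infix 4 _≈ᴹ_⟨mod_⟩
  record _≈ᴹ_⟨mod_⟩ (X Y : Mat) (n : ℕ) : Set where
    constructor mat≈
    field
      ≈₁₁ : Mat.m11 X ≡ Mat.m11 Y ⟨mod n ⟩
      ≈₁₂ : Mat.m12 X ≡ Mat.m12 Y ⟨mod n ⟩
      ≈₂₁ : Mat.m21 X ≡ Mat.m21 Y ⟨mod n ⟩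
      ≈₂₂ : Mat.m22 X ≡ Mat.m22 Y ⟨mod n ⟩

  ·-cong-mod : ∀ {n X X′ Y Y′} → X ≈ᴹ X′ ⟨mod n ⟩ → Y ≈ᴹ Y′ ⟨mod n ⟩ → X · Y ≈ᴹ X′ · Y′ ⟨mod n ⟩
  ·-cong-mod (mat≈ a b c d) (mat≈ e f g h) =
    mat≈ (mod-+ (mod-* a e) (mod-* b g)) (mod-+ (mod-* a f) (mod-* b h))
         (mod-+ (mod-* c e) (mod-* d g)) (mod-+ (mod-* c f) (mod-* d h))

  M-cong-mod : ∀ {n xs ys} → xs ≈[ n ] ys → M xs ≈ᴹ M ys ⟨mod n ⟩
  M-cong-mod Pointwise.[] = mat≈ mod-refl mod-refl mod-refl mod-refl
  M-cong-mod (x≈y Pointwise.∷ xs≈ys) =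
    ·-cong-mod (M-cong-mod xs≈ys) (mat≈ (≡[mod]⇒≡⟨mod⟩ x≈y) mod-refl mod-refl mod-refl)

  -- The body of Defs.Solution for an arbitrary matrix: Solution N c unfolds to M c ≡±Id⟨mod N ⟩.
  infix 4 _≡±Id⟨mod_⟩
  _≡±Id⟨mod_⟩ : Mat → ℕ → Set
  mat A B C D ≡±Id⟨mod N ⟩ =
    (A ≡ 1ℤ [mod N ] × B ≡ 0ℤ [mod N ] × C ≡ 0ℤ [mod N ] × D ≡ 1ℤ [mod N ])
    ⊎ (A ≡ - 1ℤ [mod N ] × B ≡ 0ℤ [mod N ] × C ≡ 0ℤ [mod N ] × D ≡ - 1ℤ [mod N ])

  ≡±Id⇒m₂₂ : ∀ {N} X → X ≡±Id⟨mod N ⟩ → Σ Sign λ s → Mat.m22 X ≡ ⟦ s ⟧ ⟨mod N ⟩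
  ≡±Id⇒m₂₂ (mat _ _ _ _) (inj₁ (_ , _ , _ , d)) = Sign.+ , ≡[mod]⇒≡⟨mod⟩ d
  ≡±Id⇒m₂₂ (mat _ _ _ _) (inj₂ (_ , _ , _ , d)) = Sign.- , ≡[mod]⇒≡⟨mod⟩ d

  reducible⇒¬irreducible : ∀ {N c} → Reducible N c → ¬ Irreducible N c
  reducible⇒¬irreducible (_ , _ , decomposition) (_ , _ , no-decomposition) = no-decomposition decomposition

  -- The ring ℤ[ξ]/(ξ² − kξ + 1)

  module QuadraticAlgebra (k : ℤ) where

    -- (α , β) stands for αξ + β.
    ℤ[ξ] : Set
    ℤ[ξ] = ℤ × ℤ

    infixl 7 _⊗_
    _⊗_ : ℤ[ξ] → ℤ[ξ] → ℤ[ξ]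
    (a , b) ⊗ (c , d) = a * c * k + a * d + b * c , b * d - a * c

    one ξ : ℤ[ξ]
    one = 0ℤ , 1ℤ
    ξ = 1ℤ , 0ℤ

    ⊗-comm : ∀ x y → x ⊗ y ≡ y ⊗ x
    ⊗-comm (a , b) (c , d) = cong₂ _,_ (solve (a ∷ b ∷ c ∷ d ∷ k ∷ [])) (solve (a ∷ b ∷ c ∷ d ∷ []))

    ⊗-assoc : ∀ x y z → (x ⊗ y) ⊗ z ≡ x ⊗ (y ⊗ z)
    ⊗-assoc (a , b) (c , d) (e , f) = cong₂ _,_ (coeff a b c d e f k) (const a b c d e f k)
      where
      coeff : ∀ a b c d e f k →
        (a * c * k + a * d + b * c) * e * k + (a * c * k + a * d + b * c) * f + (b * d - a * c) * e
          ≡ a * (c * e * k + c * f + d * e) * k + a * (d * f - c * e) + b * (c * e * k + c * f + d * e)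
      coeff = solve-∀
      const : ∀ a b c d e f k →
        (b * d - a * c) * f - (a * c * k + a * d + b * c) * e
          ≡ b * (d * f - c * e) - a * (c * e * k + c * f + d * e)
      const = solve-∀

    ⊗-identityˡ : ∀ x → one ⊗ x ≡ x
    ⊗-identityˡ (c , d) = cong₂ _,_ (solve (c ∷ d ∷ k ∷ [])) (solve (c ∷ d ∷ []))

    ⊗-commutativeMonoid : CommutativeMonoid 0ℓ 0ℓ
    ⊗-commutativeMonoid = record
      { Carrier = ℤ[ξ]
      ; _≈_ = _≡_
      ; _∙_ = _⊗_
      ; ε = one
      ; isCommutativeMonoid = record
        { isMonoid = record
          { isSemigroup = record
            { isMagma = record { isEquivalence = isEquivalence ; ∙-cong = cong₂ _⊗_ }
            ; assoc = ⊗-assoc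
            }
          ; identity = ⊗-identityˡ , λ x → trans (⊗-comm x one) (⊗-identityˡ x)
          }
        ; comm = ⊗-comm
        }
      }

    open MonoidPowers ⊗-commutativeMonoid using (×-homo-+; ×-assocˡ; ×-distrib-+)
      renaming (_×_ to _⊗-times_)

    infixr 8 _^_
    _^_ : ℤ[ξ] → ℕ → ℤ[ξ]
    x ^ n = n ⊗-times x

    ^-+ : ∀ x m n → x ^ (m ℕ.+ n) ≡ x ^ m ⊗ x ^ n
    ^-+ x m n = ×-homo-+ x m n

    ^-* : ∀ x m n → x ^ (m ℕ.* n) ≡ (x ^ n) ^ m
    ^-* x m n = sym (×-assocˡ x m n)

    ^-distrib-⊗ : ∀ x y n → (x ⊗ y) ^ n ≡ x ^ n ⊗ y ^ n
    ^-distrib-⊗ x y n = ×-distrib-+ x y n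

    U : ℕ → ℤ
    U n = proj₁ (ξ ^ n)

    ι : ℤ → ℤ[ξ]
    ι z = 0ℤ , z

    ι-⊗ : ∀ z x → ι z ⊗ x ≡ (z * proj₁ x , z * proj₂ x)
    ι-⊗ z (c , d) = cong₂ _,_ (coeff z c d k) (const z c d)
      where
      coeff : ∀ z c d k → 0ℤ * c * k + 0ℤ * d + z * c ≡ z * c
      coeff = solve-∀
      const : ∀ z c d → z * d - 0ℤ * c ≡ z * d
      const = solve-∀

    ι-* : ∀ y z → ι y ⊗ ι z ≡ ι (y * z)
    ι-* y z = trans (ι-⊗ y (ι z)) (cong (_, y * z) (ℤP.*-zeroʳ y))

    ⌜_⌝ : Sign → ℤ[ξ]
    ⌜ s ⌝ = ι ⟦ s ⟧

    ⌜⌝-* : ∀ s t → ⌜ s ⌝ ⊗ ⌜ t ⌝ ≡ ⌜ s Sign.* t ⌝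
    ⌜⌝-* s t = trans (ι-* ⟦ s ⟧ ⟦ t ⟧) (cong ι (sym (⟦⟧-* s t)))

    ⌜⌝-^ : ∀ s n → ⌜ s ⌝ ^ n ≡ ⌜ s ^ˢ n ⌝
    ⌜⌝-^ s zero = refl
    ⌜⌝-^ s (suc n) = trans (cong (⌜ s ⌝ ⊗_) (⌜⌝-^ s n)) (⌜⌝-* s (s ^ˢ n))

    ⌜⌝-cancel : ∀ s y → ⌜ s ⌝ ⊗ (⌜ s ⌝ ⊗ y) ≡ y
    ⌜⌝-cancel s y = begin
      ⌜ s ⌝ ⊗ (⌜ s ⌝ ⊗ y)  ≡⟨ ⊗-assoc ⌜ s ⌝ ⌜ s ⌝ y ⟨
      ⌜ s ⌝ ⊗ ⌜ s ⌝ ⊗ y    ≡⟨ cong (_⊗ y) (⌜⌝-* s s) ⟩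
      ⌜ s Sign.* s ⌝ ⊗ y   ≡⟨ cong (λ t → ⌜ t ⌝ ⊗ y) (Signₚ.s*s≡+ s) ⟩
      one ⊗ y              ≡⟨ ⊗-identityˡ y ⟩
      y                    ∎
      where open ≡-Reasoning

    norm : ℤ[ξ] → ℤ
    norm (a , b) = a * a + a * b * k + b * b

    norm-⊗ : ∀ x y → norm (x ⊗ y) ≡ norm x * norm y
    norm-⊗ (a , b) (c , d) = identity a b c d k
      where
      identity : ∀ a b c d k →
        let e = a * c * k + a * d + b * c ; f = b * d - a * c in
        e * e + e * f * k + f * f ≡ (a * a + a * b * k + b * b) * (c * c + c * d * k + d * d)
      identity = solve-∀

    norm-ξ^ : ∀ n → norm (ξ ^ n) ≡ 1ℤ
    norm-ξ^ zero = refl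
    norm-ξ^ (suc n) = trans (norm-⊗ ξ (ξ ^ n)) (cong (norm ξ *_) (norm-ξ^ n))

    M-replicate : ∀ n → M (replicate n k) ≡ mat (U (suc n)) (- U n) (U n) (proj₂ (ξ ^ n))
    M-replicate zero = refl
    M-replicate (suc n) = trans (cong (_· Mk k) (M-replicate n)) (step (ξ ^ n))
      where
      step : ∀ x → mat (proj₁ (ξ ⊗ x)) (- proj₁ x) (proj₁ x) (proj₂ x) · Mk k
                   ≡ mat (proj₁ (ξ ⊗ (ξ ⊗ x))) (- proj₁ (ξ ⊗ x)) (proj₁ (ξ ⊗ x)) (proj₂ (ξ ⊗ x))
      step (α , β) = mat-cong (e₁₁ α β k) (e₁₂ α β k) (e₂₁ α β k) (e₂₂ α β)
        where
        e₁₁ : ∀ α β k → let e = 1ℤ * α * k + 1ℤ * β + 0ℤ * α in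
          e * k + (- α) * 1ℤ ≡ 1ℤ * e * k + 1ℤ * (0ℤ * β - 1ℤ * α) + 0ℤ * e
        e₁₁ = solve-∀
        e₁₂ : ∀ α β k → let e = 1ℤ * α * k + 1ℤ * β + 0ℤ * α in
          e * (- 1ℤ) + (- α) * 0ℤ ≡ - e
        e₁₂ = solve-∀
        e₂₁ : ∀ α β k → α * k + β * 1ℤ ≡ 1ℤ * α * k + 1ℤ * β + 0ℤ * α
        e₂₁ = solve-∀
        e₂₂ : ∀ α β → α * (- 1ℤ) + β * 0ℤ ≡ 0ℤ * β - 1ℤ * α
        e₂₂ = solve-∀

    infix 4 _≈_⟨mod_⟩
    record _≈_⟨mod_⟩ (x y : ℤ[ξ]) (n : ℕ) : Set where
      constructor _&_
      field
        coeff-≡ : proj₁ x ≡ proj₁ y ⟨mod n ⟩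
        const-≡ : proj₂ x ≡ proj₂ y ⟨mod n ⟩
    open _≈_⟨mod_⟩ public

    ≈-refl : ∀ {n x} → x ≈ x ⟨mod n ⟩
    ≈-refl = mod-refl & mod-refl

    ≈-reflexive : ∀ {n x y} → x ≡ y → x ≈ y ⟨mod n ⟩
    ≈-reflexive refl = ≈-refl

    ≈-sym : ∀ {n x y} → x ≈ y ⟨mod n ⟩ → y ≈ x ⟨mod n ⟩
    ≈-sym (a & b) = mod-sym a & mod-sym b

    ≈-trans : ∀ {n x y z} → x ≈ y ⟨mod n ⟩ → y ≈ z ⟨mod n ⟩ → x ≈ z ⟨mod n ⟩
    ≈-trans (a & b) (c & d) = mod-trans a c & mod-trans b d

    ≈-∣ : ∀ {d n x y} → d ℕD.∣ n → x ≈ y ⟨mod n ⟩ → x ≈ y ⟨mod d ⟩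
    ≈-∣ d∣n (a & b) = mod-∣ d∣n a & mod-∣ d∣n b

    ≈-setoid : ℕ → Setoid 0ℓ 0ℓ
    ≈-setoid n = record
      { Carrier = ℤ[ξ]
      ; _≈_ = _≈_⟨mod n ⟩
      ; isEquivalence = record { refl = ≈-refl ; sym = ≈-sym ; trans = ≈-trans }
      }

    ⊗-cong : ∀ {n x x′ y y′} → x ≈ x′ ⟨mod n ⟩ → y ≈ y′ ⟨mod n ⟩ → x ⊗ y ≈ x′ ⊗ y′ ⟨mod n ⟩
    ⊗-cong (a & b) (c & d) =
      mod-+ (mod-+ (mod-*ʳ k (mod-* a c)) (mod-* a d)) (mod-* b c) & mod-- (mod-* b d) (mod-* a c)

    infix 4 ξ^[_]≡_⟨mod_⟩
    record ξ^[_]≡_⟨mod_⟩ (i : ℕ) (s : Sign) (n : ℕ) : Set where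
      constructor power≡
      field ≈⌜sign⌝ : ξ ^ i ≈ ⌜ s ⌝ ⟨mod n ⟩

    ξ^[0]≡+ : ∀ {n} → ξ^[ 0 ]≡ Sign.+ ⟨mod n ⟩
    ξ^[0]≡+ = power≡ ≈-refl

    ξ^[]-+ : ∀ {n i j s t} → ξ^[ i ]≡ s ⟨mod n ⟩ → ξ^[ j ]≡ t ⟨mod n ⟩ → ξ^[ i ℕ.+ j ]≡ s Sign.* t ⟨mod n ⟩
    ξ^[]-+ {i = i} {j} {s} {t} (power≡ x) (power≡ y) = power≡ (≈-trans (≈-reflexive (^-+ ξ i j))
      (≈-trans (⊗-cong x y) (≈-reflexive (⌜⌝-* s t))))

    ξ^[]-∸ : ∀ {n i j s t} → ξ^[ i ℕ.+ j ]≡ s ⟨mod n ⟩ → ξ^[ i ]≡ t ⟨mod n ⟩ → ξ^[ j ]≡ t Sign.* s ⟨mod n ⟩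
    ξ^[]-∸ {n} {i} {j} {s} {t} (power≡ x) (power≡ y) = power≡ (begin
      ξ ^ j                          ≡⟨ ⌜⌝-cancel t (ξ ^ j) ⟨
      ⌜ t ⌝ ⊗ (⌜ t ⌝ ⊗ ξ ^ j)         ≈⟨ ⊗-cong (≈-refl {x = ⌜ t ⌝}) (⊗-cong (≈-sym y) ≈-refl) ⟩
      ⌜ t ⌝ ⊗ (ξ ^ i ⊗ ξ ^ j)         ≡⟨ cong (⌜ t ⌝ ⊗_) (^-+ ξ i j) ⟨
      ⌜ t ⌝ ⊗ ξ ^ (i ℕ.+ j)          ≈⟨ ⊗-cong (≈-refl {x = ⌜ t ⌝}) x ⟩
      ⌜ t ⌝ ⊗ ⌜ s ⌝                  ≡⟨ ⌜⌝-* t s ⟩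
      ⌜ t Sign.* s ⌝                 ∎)
      where open SetoidReasoning (≈-setoid n)

    ξ^[]-* : ∀ {n i s} r → ξ^[ i ]≡ s ⟨mod n ⟩ → ξ^[ r ℕ.* i ]≡ s ^ˢ r ⟨mod n ⟩
    ξ^[]-* zero x = ξ^[0]≡+
    ξ^[]-* (suc r) x = ξ^[]-+ x (ξ^[]-* r x)

    ξ^[]-∣ : ∀ {d n i s} → d ℕD.∣ n → ξ^[ i ]≡ s ⟨mod n ⟩ → ξ^[ i ]≡ s ⟨mod d ⟩
    ξ^[]-∣ d∣n (power≡ x) = power≡ (≈-∣ d∣n x)

    ξ^[]-crt : ∀ {m n i s} → Coprime m n → ξ^[ i ]≡ s ⟨mod m ⟩ → ξ^[ i ]≡ s ⟨mod n ⟩ →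
               ξ^[ i ]≡ s ⟨mod m ℕ.* n ⟩
    ξ^[]-crt c (power≡ (a & b)) (power≡ (a′ & b′)) = power≡ (mod-crt c a a′ & mod-crt c b b′)

    ξ^[]-sign-unique : ∀ {n i s t} → 3 ≤ n → ξ^[ i ]≡ s ⟨mod n ⟩ → ξ^[ i ]≡ t ⟨mod n ⟩ → s ≡ t
    ξ^[]-sign-unique n≥3 (power≡ x) (power≡ y) = ⟦⟧-injective-mod n≥3 (mod-trans (mod-sym (const-≡ x)) (const-≡ y))

    ξ^[_]≟_⟨mod_⟩ : ∀ i s n → Dec (ξ^[ i ]≡ s ⟨mod n ⟩)
    ξ^[ i ]≟ s ⟨mod n ⟩ = Dec.map′ (λ (a , b) → power≡ (a & b)) (λ (power≡ (a & b)) → a , b)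
      (U i ≡? 0ℤ ⟨mod n ⟩ ×-dec proj₂ (ξ ^ i) ≡? ⟦ s ⟧ ⟨mod n ⟩)

    solution⇒ξ^[] : ∀ {N i} → Solution N (replicate i k) → Σ Sign (ξ^[ i ]≡_⟨mod N ⟩)
    solution⇒ξ^[] {N} {i} sol with subst (_≡±Id⟨mod N ⟩) (M-replicate i) sol
    ... | inj₁ (_ , _ , c , d) = Sign.+ , power≡ (≡[mod]⇒≡⟨mod⟩ c & ≡[mod]⇒≡⟨mod⟩ d)
    ... | inj₂ (_ , _ , c , d) = Sign.- , power≡ (≡[mod]⇒≡⟨mod⟩ c & ≡[mod]⇒≡⟨mod⟩ d)

    ξ^[]⇒solution : ∀ {N i s} → ξ^[ i ]≡ s ⟨mod N ⟩ → Solution N (replicate i k)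
    ξ^[]⇒solution {N} {i} {s} (power≡ x@(c & d)) =
      subst (_≡±Id⟨mod N ⟩) (sym (M-replicate i)) (entries s top d)
      where
      ξ⊗ι : ∀ z → proj₁ (ξ ⊗ ι z) ≡ z
      ξ⊗ι z = trans (cong proj₁ (⊗-comm ξ (ι z))) (trans (cong proj₁ (ι-⊗ z ξ)) (ℤP.*-identityʳ z))
      top : U (suc i) ≡ ⟦ s ⟧ ⟨mod N ⟩
      top = mod-trans (coeff-≡ (⊗-cong (≈-refl {x = ξ}) x)) (mod-reflexive (ξ⊗ι ⟦ s ⟧))
      entries : ∀ s → U (suc i) ≡ ⟦ s ⟧ ⟨mod N ⟩ → proj₂ (ξ ^ i) ≡ ⟦ s ⟧ ⟨mod N ⟩ →
                mat (U (suc i)) (- U i) (U i) (proj₂ (ξ ^ i)) ≡±Id⟨mod N ⟩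
      entries Sign.+ a b = inj₁ (≡⟨mod⟩⇒≡[mod] a , ≡⟨mod⟩⇒≡[mod] (mod-neg c) , ≡⟨mod⟩⇒≡[mod] c , ≡⟨mod⟩⇒≡[mod] b)
      entries Sign.- a b = inj₂ (≡⟨mod⟩⇒≡[mod] a , ≡⟨mod⟩⇒≡[mod] (mod-neg c) , ≡⟨mod⟩⇒≡[mod] c , ≡⟨mod⟩⇒≡[mod] b)

    -- h is the order of ξ modulo ±1, i.e. the size of the monomial minimal solution, and ξʰ ≡ s₀.
    record ProjectiveOrder (n h : ℕ) (s₀ : Sign) : Set where
      field
        positive : 1 ≤ h
        power : ξ^[ h ]≡ s₀ ⟨mod n ⟩
        minimal : ∀ {m s} → 1 ≤ m → m < h → ¬ ξ^[ m ]≡ s ⟨mod n ⟩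

    -- The remainder of i modulo h is an exponent below h with ξ^(i mod h) ≡ ±1, hence it is 0.
    period : ∀ {n h s₀ i s} → 3 ≤ n → ProjectiveOrder n h s₀ → ξ^[ i ]≡ s ⟨mod n ⟩ →
             ∃ λ r → i ≡ r ℕ.* h × s ≡ s₀ ^ˢ r
    period {n} {h} {s₀} {i} {s} n≥3 ord x = r , i≡r*h , *≡+⇒≡ (ξ^[]-sign-unique n≥3 remainder′ ξ^[0]≡+)
      where
      open ProjectiveOrder ord
      instance
        h≢0 : ℕ.NonZero h
        h≢0 = ℕ.>-nonZero positive
      r : ℕ
      r = i ℕ./ h
      division : r ℕ.* h ℕ.+ i ℕ.% h ≡ i
      division = trans (ℕP.+-comm (r ℕ.* h) _) (sym (ℕDM.m≡m%n+[m/n]*n i h))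
      remainder : ξ^[ i ℕ.% h ]≡ s₀ ^ˢ r Sign.* s ⟨mod n ⟩
      remainder = ξ^[]-∸ (subst (ξ^[_]≡ s ⟨mod n ⟩) (sym division) x) (ξ^[]-* r power)
      below-order : ∀ {j t} → j < h → ξ^[ j ]≡ t ⟨mod n ⟩ → j ≡ 0
      below-order {zero} _ _ = refl
      below-order {suc j} j<h y = contradiction y (minimal (s≤s z≤n) j<h)
      remainder≡0 : i ℕ.% h ≡ 0
      remainder≡0 = below-order (ℕDM.m%n<n i h) remainder
      remainder′ : ξ^[ 0 ]≡ s₀ ^ˢ r Sign.* s ⟨mod n ⟩
      remainder′ = subst (ξ^[_]≡ s₀ ^ˢ r Sign.* s ⟨mod n ⟩) remainder≡0 remainder
      i≡r*h : i ≡ r ℕ.* h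
      i≡r*h = trans (sym division) (trans (cong (r ℕ.* h ℕ.+_) remainder≡0) (ℕP.+-identityʳ _))

    -- x ⊗ x = (αγ , β² − α²) with γ = αk + 2β, and if γ ≡ 0 then 8 = 4βγ − 4(β² − α² − 1) − 4(norm x − 1) ≡ 0.
    square≈one⇒≈± : ∀ {p x} → Prime p → ¬ + 8 ≡ 0ℤ ⟨mod p ⟩ → norm x ≡ 1ℤ → x ⊗ x ≈ one ⟨mod p ⟩ →
                    Σ Sign λ s → x ≈ ⌜ s ⌝ ⟨mod p ⟩
    square≈one⇒≈± {p} {α , β} pr 8≢0 norm≡1 (c & d) = Sum.[ α≡0⇒≈± , (λ γ≡0 → contradiction γ≡0 γ≢0) ]′ (mod-euclid pr αγ≡0)
      where
      open mod-Reasoning p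
      γ : ℤ
      γ = α * k + β + β
      αγ≡0 : α * γ ≡ 0ℤ ⟨mod p ⟩
      αγ≡0 = mod-trans (mod-reflexive (factor α β k)) c
        where
        factor : ∀ α β k → α * (α * k + β + β) ≡ α * α * k + α * β + β * α
        factor = solve-∀
      α≡0⇒≈± : α ≡ 0ℤ ⟨mod p ⟩ → Σ Sign λ s → (α , β) ≈ ⌜ s ⌝ ⟨mod p ⟩
      α≡0⇒≈± α≡0 = Sum.[ (λ b → Sign.+ , α≡0 & mod-≡0⇒ b) , (λ b → Sign.- , α≡0 & mod-≡0⇒ b) ]′
        (mod-euclid pr (begin
          (β - 1ℤ) * (β + 1ℤ)             ≡⟨ difference-of-squares α β ⟩
          (β * β - α * α) + α * α - 1ℤ    ≈⟨ mod-- (mod-+ d (mod-* α≡0 α≡0)) mod-refl ⟩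
          1ℤ + 0ℤ * 0ℤ - 1ℤ               ≡⟨⟩
          0ℤ                              ∎))
        where
        difference-of-squares : ∀ α β → (β - 1ℤ) * (β + 1ℤ) ≡ (β * β - α * α) + α * α - 1ℤ
        difference-of-squares = solve-∀
      γ≢0 : ¬ γ ≡ 0ℤ ⟨mod p ⟩
      γ≢0 γ≡0 = 8≢0 (begin
        + 8                                                                  ≡⟨ eight α β k ⟩
        + 4 * β * γ - + 4 * (β * β - α * α - 1ℤ) - + 4 * (norm (α , β) - 1ℤ)
          ≈⟨ mod-- (mod-- (mod-*ˡ (+ 4 * β) γ≡0) (mod-*ˡ (+ 4) (mod-⇒≡0 d)))
                   (mod-*ˡ (+ 4) (mod-⇒≡0 (mod-reflexive norm≡1))) ⟩
        + 4 * β * 0ℤ - + 4 * 0ℤ - + 4 * 0ℤ                                   ≡⟨ vanish β ⟩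
        0ℤ                                                                   ∎)
        where
        eight : ∀ α β k → + 8 ≡ + 4 * β * (α * k + β + β) - + 4 * (β * β - α * α - 1ℤ)
                                 - + 4 * (α * α + α * β * k + β * β - 1ℤ)
        eight = solve-∀
        vanish : ∀ β → + 4 * β * 0ℤ - + 4 * 0ℤ - + 4 * 0ℤ ≡ 0ℤ
        vanish = solve-∀

    binomial-≈ : ∀ P a b n →
      (+ P * a , 1ℤ + + P * b) ^ n ≈ (+ n * (+ P * a) , 1ℤ + + n * (+ P * b)) ⟨mod P ℕ.* P ⟩
    binomial-≈ P a b zero = ≈-refl
    binomial-≈ P a b (suc n) = begin
      y ⊗ y ^ n                                                  ≈⟨ ⊗-cong (≈-refl {x = y}) (binomial-≈ P a b n) ⟩
      y ⊗ (+ n * (+ P * a) , 1ℤ + + n * (+ P * b))               ≡⟨ cong₂ _,_ first second ⟩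
      (+ suc n * (+ P * a) + w₁ * + (P ℕ.* P) ,
       1ℤ + + suc n * (+ P * b) + w₂ * + (P ℕ.* P))              ≈⟨ mod-+-multiple _ w₁ & mod-+-multiple _ w₂ ⟩
      (+ suc n * (+ P * a) , 1ℤ + + suc n * (+ P * b))           ∎
      where
      open SetoidReasoning (≈-setoid (P ℕ.* P))
      y : ℤ[ξ]
      y = (+ P * a , 1ℤ + + P * b)
      w₁ w₂ : ℤ
      w₁ = + n * (a * a * k + + 2 * a * b)
      w₂ = + n * (b * b - a * a)
      P² : + P * + P ≡ + (P ℕ.* P)
      P² = sym (ℤP.pos-* P P)
      expand₁ : ∀ P a b N k →
        P * a * (N * (P * a)) * k + P * a * (1ℤ + N * (P * b)) + (1ℤ + P * b) * (N * (P * a))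
          ≡ (1ℤ + N) * (P * a) + N * (a * a * k + + 2 * a * b) * (P * P)
      expand₁ = solve-∀
      expand₂ : ∀ P a b N →
        (1ℤ + P * b) * (1ℤ + N * (P * b)) - P * a * (N * (P * a))
          ≡ 1ℤ + (1ℤ + N) * (P * b) + N * (b * b - a * a) * (P * P)
      expand₂ = solve-∀
      first : proj₁ (y ⊗ (+ n * (+ P * a) , 1ℤ + + n * (+ P * b))) ≡ + suc n * (+ P * a) + w₁ * + (P ℕ.* P)
      first = trans (expand₁ (+ P) a b (+ n) k) (cong (λ z → + suc n * (+ P * a) + w₁ * z) P²)
      second : proj₂ (y ⊗ (+ n * (+ P * a) , 1ℤ + + n * (+ P * b))) ≡ 1ℤ + + suc n * (+ P * b) + w₂ * + (P ℕ.* P)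
      second = trans (expand₂ (+ P) a b (+ n)) (cong (λ z → 1ℤ + + suc n * (+ P * b) + w₂ * z) P²)

    -- Write y = (P t₁ , 1 + P t₂): then yᵖ ≡ (pP t₁ , 1 + pP t₂) mod P², and pP ∣ P² since p ∣ P.
    ≈one-lift : ∀ p Q {y} → y ≈ one ⟨mod p ℕ.* Q ⟩ → y ^ p ≈ one ⟨mod p ℕ.* (p ℕ.* Q) ⟩
    ≈one-lift p Q {a , b} (congruent (divides t₁ e₁) & congruent (divides t₂ e₂)) = begin
      (a , b) ^ p                                  ≡⟨ cong (_^ p) (cong₂ _,_ a≡ b≡) ⟩
      (+ P * t₁ , 1ℤ + + P * t₂) ^ p               ≈⟨ ≈-∣ (ℕD.*-monoˡ-∣ P (ℕD.m∣m*n {p} Q)) (binomial-≈ P t₁ t₂ p) ⟩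
      (+ p * (+ P * t₁) , 1ℤ + + p * (+ P * t₂))    ≈⟨ multiple t₁ & mod-+ (mod-refl {x = 1ℤ}) (multiple t₂) ⟩
      one                                          ∎
      where
      open SetoidReasoning (≈-setoid (p ℕ.* (p ℕ.* Q)))
      P : ℕ
      P = p ℕ.* Q
      shift : ∀ b → b ≡ 1ℤ + (b - 1ℤ)
      shift = solve-∀
      a≡ : a ≡ + P * t₁
      a≡ = trans (sym (ℤP.+-identityʳ a)) (trans e₁ (ℤP.*-comm t₁ (+ P)))
      b≡ : b ≡ 1ℤ + + P * t₂
      b≡ = trans (shift b) (cong (λ z → 1ℤ + z) (trans e₂ (ℤP.*-comm t₂ (+ P))))
      multiple : ∀ t → + p * (+ P * t) ≡ 0ℤ ⟨mod p ℕ.* P ⟩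
      multiple t = mod-trans (mod-reflexive (trans (sym (ℤP.*-assoc (+ p) (+ P) t))
                                                   (cong (_* t) (sym (ℤP.pos-* p P)))))
                             (mod-multiple t)

    ξ^[]-lift : ∀ {p Q i s} → s ^ˢ p ≡ s → ξ^[ i ]≡ s ⟨mod p ℕ.* Q ⟩ → ξ^[ p ℕ.* i ]≡ s ⟨mod p ℕ.* (p ℕ.* Q) ⟩
    ξ^[]-lift {p} {Q} {i} {s} sᵖ≡s (power≡ x) = power≡ (begin
      ξ ^ (p ℕ.* i)           ≡⟨ ^-* ξ p i ⟩
      (ξ ^ i) ^ p             ≡⟨ cong (_^ p) (⌜⌝-cancel s (ξ ^ i)) ⟨
      (⌜ s ⌝ ⊗ y) ^ p         ≡⟨ ^-distrib-⊗ ⌜ s ⌝ y p ⟩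
      ⌜ s ⌝ ^ p ⊗ y ^ p       ≈⟨ ⊗-cong (≈-refl {x = ⌜ s ⌝ ^ p}) (≈one-lift p Q y≈one) ⟩
      ⌜ s ⌝ ^ p ⊗ one         ≡⟨ ⊗-comm (⌜ s ⌝ ^ p) one ⟩
      one ⊗ ⌜ s ⌝ ^ p         ≡⟨ ⊗-identityˡ (⌜ s ⌝ ^ p) ⟩
      ⌜ s ⌝ ^ p               ≡⟨ ⌜⌝-^ s p ⟩
      ⌜ s ^ˢ p ⌝              ≡⟨ cong ⌜_⌝ sᵖ≡s ⟩
      ⌜ s ⌝                   ∎)
      where
      open SetoidReasoning (≈-setoid (p ℕ.* (p ℕ.* Q)))
      y : ℤ[ξ]
      y = ⌜ s ⌝ ⊗ ξ ^ i
      y≈one : y ≈ one ⟨mod p ℕ.* Q ⟩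
      y≈one = ≈-trans (⊗-cong (≈-refl {x = ⌜ s ⌝}) x) (≈-reflexive (trans (⌜⌝-* s s) (cong ⌜_⌝ (Signₚ.s*s≡+ s))))

    ξ^[]-lift-pow : ∀ {p i s} → s ^ˢ p ≡ s → ξ^[ i ]≡ s ⟨mod p ⟩ →
                    ∀ r → ξ^[ p ℕ.^ r ℕ.* i ]≡ s ⟨mod p ℕ.^ suc r ⟩
    ξ^[]-lift-pow {p} {i} {s} sᵖ≡s x zero =
      subst₂ (ξ^[_]≡ s ⟨mod_⟩) (sym (ℕP.*-identityˡ i)) (sym (ℕP.*-identityʳ p)) x
    ξ^[]-lift-pow {p} {i} {s} sᵖ≡s x (suc r) =
      subst (ξ^[_]≡ s ⟨mod p ℕ.^ suc (suc r) ⟩) (sym (ℕP.*-assoc p (p ℕ.^ r) i))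
            (ξ^[]-lift {p} {p ℕ.^ r} sᵖ≡s (ξ^[]-lift-pow sᵖ≡s x r))

    ξ^[]-halve : ∀ {p c} → Prime p → ¬ + 8 ≡ 0ℤ ⟨mod p ⟩ →
                 ξ^[ c ℕ.+ c ]≡ Sign.+ ⟨mod p ⟩ → Σ Sign (ξ^[ c ]≡_⟨mod p ⟩)
    ξ^[]-halve {c = c} pr 8≢0 (power≡ x) =
      Product.map₂ power≡ (square≈one⇒≈± pr 8≢0 (norm-ξ^ c) (≈-trans (≈-reflexive (sym (^-+ ξ c c))) x))

    even-order⇒antipodal : ∀ {p c s₀} → Prime p → ¬ + 8 ≡ 0ℤ ⟨mod p ⟩ → 1 ≤ c →
                           ProjectiveOrder p (c ℕ.+ c) s₀ → s₀ ≡ Sign.-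
    even-order⇒antipodal {s₀ = Sign.-} _ _ _ _ = refl
    even-order⇒antipodal {p} {c} {Sign.+} pr 8≢0 1≤c ord =
      contradiction (proj₂ (ξ^[]-halve pr 8≢0 power)) (minimal 1≤c (ℕP.m<m+n c 1≤c))
      where open ProjectiveOrder ord

    ξ^≈⟨mod4⟩ : k ≡ + 2 ⟨mod 4 ⟩ → ∀ n → ξ ^ n ≈ (+ n , 1ℤ - + n) ⟨mod 4 ⟩
    ξ^≈⟨mod4⟩ k≡2 zero = ≈-refl
    ξ^≈⟨mod4⟩ k≡2 (suc n) with ξ^≈⟨mod4⟩ k≡2 n
    ... | a & b = mod-trans (mod-+ (mod-+ (mod-* (mod-*ˡ 1ℤ a) k≡2) (mod-*ˡ 1ℤ b)) (mod-*ˡ 0ℤ a))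
                            (mod-reflexive (coeff (+ n)))
                & mod-trans (mod-- (mod-*ˡ 0ℤ b) (mod-*ˡ 1ℤ a)) (mod-reflexive (const (+ n)))
      where
      coeff : ∀ m → 1ℤ * m * + 2 + 1ℤ * (1ℤ - m) + 0ℤ * m ≡ 1ℤ + m
      coeff = solve-∀
      const : ∀ m → 0ℤ * (1ℤ - m) - 1ℤ * m ≡ 1ℤ - (1ℤ + m)
      const = solve-∀

    U≡n⟨mod4⟩ : k ≡ + 2 ⟨mod 4 ⟩ → ∀ n → U n ≡ + n ⟨mod 4 ⟩
    U≡n⟨mod4⟩ k≡2 n = coeff-≡ (ξ^≈⟨mod4⟩ k≡2 n)

    ξ^[]⟨mod4⟩ : ∀ {n s} → k ≡ + 2 ⟨mod 4 ⟩ → ξ^[ n ]≡ s ⟨mod 4 ⟩ → 4 ℕD.∣ n × s ≡ Sign.+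
    ξ^[]⟨mod4⟩ {n} {s} k≡2 (power≡ (a & b)) = mod-≡0⇒∣ n≡0 , sym (⟦⟧-injective-mod 3≤4 1≡s)
      where
      3≤4 : 3 ≤ 4
      3≤4 = ℕP.n≤1+n 3
      n≡0 : + n ≡ 0ℤ ⟨mod 4 ⟩
      n≡0 = mod-trans (mod-sym (U≡n⟨mod4⟩ k≡2 n)) a
      1≡s : 1ℤ ≡ ⟦ s ⟧ ⟨mod 4 ⟩
      1≡s = mod-trans (mod-- (mod-refl {x = 1ℤ}) (mod-sym n≡0)) (mod-trans (mod-sym (const-≡ (ξ^≈⟨mod4⟩ k≡2 n))) b)

    4∣⇒ξ^[]≡+⟨mod4⟩ : ∀ {n} → k ≡ + 2 ⟨mod 4 ⟩ → 4 ℕD.∣ n → ξ^[ n ]≡ Sign.+ ⟨mod 4 ⟩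
    4∣⇒ξ^[]≡+⟨mod4⟩ {n} k≡2 4∣n with ξ^≈⟨mod4⟩ k≡2 n
    ... | a & b = power≡ (mod-trans a n≡0 & mod-trans b (mod-- (mod-refl {x = 1ℤ}) n≡0))
      where
      n≡0 : + n ≡ 0ℤ ⟨mod 4 ⟩
      n≡0 = ∣⇒mod-≡0 4∣n

    ξ-⊗ : ∀ a b → ξ ⊗ (a , b) ≡ (a * k + b , - a)
    ξ-⊗ a b = cong₂ _,_ (coeff a b k) (const a b)
      where
      coeff : ∀ a b k → 1ℤ * a * k + 1ℤ * b + 0ℤ * a ≡ a * k + b
      coeff = solve-∀
      const : ∀ a b → 0ℤ * b - 1ℤ * a ≡ - a
      const = solve-∀

    ξ²≡ : ξ ^ 2 ≡ (k , - 1ℤ)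
    ξ²≡ = trans (ξ-⊗ 1ℤ 0ℤ) (cong (_, - 1ℤ) (unit k))
      where
      unit : ∀ k → 1ℤ * k + 0ℤ ≡ k
      unit = solve-∀

    β≡d-αk : ∀ {n j d} → U (suc j) ≡ d ⟨mod n ⟩ → proj₂ (ξ ^ j) ≡ d - U j * k ⟨mod n ⟩
    β≡d-αk {n} {j} {d} c = begin
      β                    ≡⟨ unshift α β k ⟩
      α * k + β - α * k    ≡⟨ cong (_- α * k) (cong proj₁ (ξ-⊗ α β)) ⟨
      U (suc j) - α * k    ≈⟨ mod-- c (mod-refl {x = α * k}) ⟩
      d - α * k            ∎
      where
      open mod-Reasoning n
      α β : ℤ
      α = U j
      β = proj₂ (ξ ^ j)
      unshift : ∀ α β k → β ≡ α * k + β - α * k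
      unshift = solve-∀

    -- Norm 1 turns U (j + 1) ≡ δ into U j · (U j − δk) ≡ 0.
    U·[U-δk]≡0 : ∀ {n j} δ → U (suc j) ≡ ⟦ δ ⟧ ⟨mod n ⟩ → U j * (U j - ⟦ δ ⟧ * k) ≡ 0ℤ ⟨mod n ⟩
    U·[U-δk]≡0 {n} {j} δ c = begin
      α * (α - d * k)                           ≡⟨ factor α β d k ⟩
      norm (α , β) - d * d - (β - (d - α * k)) * F  ≈⟨ mod-- (mod-- (mod-reflexive (norm-ξ^ j))
                                                                   (mod-reflexive (⟦⟧-square δ)))
                                                            (mod-*ʳ F (mod-⇒≡0 (β≡d-αk {n} {j} c))) ⟩
      1ℤ - 1ℤ - 0ℤ * F                          ≡⟨ cong (λ z → 0ℤ - z) (ℤP.*-zeroˡ F) ⟩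
      0ℤ                                        ∎
      where
      open mod-Reasoning n
      α β d F : ℤ
      α = U j
      β = proj₂ (ξ ^ j)
      d = ⟦ δ ⟧
      F = α * k + + 2 * (d - α * k) + (α * k + β - d)
      factor : ∀ α β d k → α * (α - d * k)
                 ≡ (α * α + α * β * k + β * β) - d * d
                   - (β - (d - α * k)) * (α * k + + 2 * (d - α * k) + (α * k + β - d))
      factor = solve-∀

    U≡0⇒ξ^[]≡ : ∀ {n j} δ → U (suc j) ≡ ⟦ δ ⟧ ⟨mod n ⟩ → U j ≡ 0ℤ ⟨mod n ⟩ → ξ^[ j ]≡ δ ⟨mod n ⟩
    U≡0⇒ξ^[]≡ {n} {j} δ c α≡0 = power≡ (α≡0 & (begin
      proj₂ (ξ ^ j)        ≈⟨ β≡d-αk {n} {j} c ⟩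
      ⟦ δ ⟧ - U j * k      ≈⟨ mod-- (mod-refl {x = ⟦ δ ⟧}) (mod-*ʳ k α≡0) ⟩
      ⟦ δ ⟧ - 0ℤ * k       ≡⟨ ℤP.+-identityʳ ⟦ δ ⟧ ⟩
      ⟦ δ ⟧                ∎))
      where open mod-Reasoning n

    U≡δk⇒ξ^[2+]≡- : ∀ {n j} δ → U (suc j) ≡ ⟦ δ ⟧ ⟨mod n ⟩ → U j ≡ ⟦ δ ⟧ * k ⟨mod n ⟩ →
                    ξ^[ 2 ℕ.+ j ]≡ Sign.- Sign.* δ ⟨mod n ⟩
    U≡δk⇒ξ^[2+]≡- {n} {j} δ c α≡dk =
      power≡ (≈-trans (≈-reflexive (trans (^-+ ξ 2 j) (cong (_⊗ ξ ^ j) ξ²≡))) (coeff≡0 & const≡-d))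
      where
      open mod-Reasoning n
      α β d : ℤ
      α = U j
      β = proj₂ (ξ ^ j)
      d = ⟦ δ ⟧
      β≡ : β ≡ d - d * k * k ⟨mod n ⟩
      β≡ = mod-trans (β≡d-αk {n} {j} c) (mod-- (mod-refl {x = d}) (mod-*ʳ k α≡dk))
      coeff≡0 : k * α * k + k * β + - 1ℤ * α ≡ 0ℤ ⟨mod n ⟩
      coeff≡0 = begin
        k * α * k + k * β + - 1ℤ * α                           ≈⟨ mod-+ (mod-+ (mod-*ʳ k (mod-*ˡ k α≡dk)) (mod-*ˡ k β≡))
                                                                       (mod-*ˡ (- 1ℤ) α≡dk) ⟩
        k * (d * k) * k + k * (d - d * k * k) + - 1ℤ * (d * k) ≡⟨ cancels d k ⟩
        0ℤ                                                     ∎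
        where
        cancels : ∀ d k → k * (d * k) * k + k * (d - d * k * k) + - 1ℤ * (d * k) ≡ 0ℤ
        cancels = solve-∀
      const≡-d : - 1ℤ * β - k * α ≡ ⟦ Sign.- Sign.* δ ⟧ ⟨mod n ⟩
      const≡-d = begin
        - 1ℤ * β - k * α                     ≈⟨ mod-- (mod-*ˡ (- 1ℤ) β≡) (mod-*ˡ k α≡dk) ⟩
        - 1ℤ * (d - d * k * k) - k * (d * k) ≡⟨ negate d k ⟩
        - 1ℤ * d                             ≡⟨ ⟦⟧-* Sign.- δ ⟨
        ⟦ Sign.- Sign.* δ ⟧                  ∎
        where
        negate : ∀ d k → - 1ℤ * (d - d * k * k) - k * (d * k) ≡ - 1ℤ * d
        negate = solve-∀

    U≡±1-dichotomy : ∀ {p m j δ} → Prime p → ¬ k ≡ 0ℤ ⟨mod p ⟩ → U (suc j) ≡ ⟦ δ ⟧ ⟨mod p ℕ.^ m ⟩ →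
                     ξ^[ j ]≡ δ ⟨mod p ℕ.^ m ⟩ ⊎ ξ^[ 2 ℕ.+ j ]≡ Sign.- Sign.* δ ⟨mod p ℕ.^ m ⟩
    U≡±1-dichotomy {p} {m} {j} {δ} pr k≢0 c =
      Sum.map (U≡0⇒ξ^[]≡ δ c) (U≡δk⇒ξ^[2+]≡- δ c) (mod-prime-power-roots m pr δk≢0 (U·[U-δk]≡0 {p ℕ.^ m} {j} δ c))
      where
      δk≢0 : ¬ ⟦ δ ⟧ * k ≡ 0ℤ ⟨mod p ⟩
      δk≢0 δk≡0 = k≢0 (mod-trans (mod-reflexive (sym (unit ⟦ δ ⟧ k (⟦⟧-square δ))))
                                 (mod-trans (mod-*ˡ ⟦ δ ⟧ δk≡0) (mod-reflexive (ℤP.*-zeroʳ ⟦ δ ⟧))))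
        where
        unit : ∀ d k → d * d ≡ 1ℤ → d * (d * k) ≡ k
        unit d k d²≡1 = trans (sym (ℤP.*-assoc d d k)) (trans (cong (_* k) d²≡1) (ℤP.*-identityˡ k))

    solution? : ∀ N i → Dec (Solution N (replicate i k))
    solution? N i with ξ^[ i ]≟ Sign.+ ⟨mod N ⟩ | ξ^[ i ]≟ Sign.- ⟨mod N ⟩
    ... | yes x | _ = yes (ξ^[]⇒solution x)
    ... | no _ | yes x = yes (ξ^[]⇒solution x)
    ... | no ¬x₊ | no ¬x₋ = no λ sol → case-sign (solution⇒ξ^[] sol)
      where
      case-sign : ¬ Σ Sign (ξ^[ i ]≡_⟨mod N ⟩)
      case-sign (Sign.+ , x) = ¬x₊ x
      case-sign (Sign.- , x) = ¬x₋ x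

    minimalSize-exists : ∀ {N n} → 1 ≤ n → Solution N (replicate n k) → ∃ (IsMonomialMinimalSize N k)
    minimalSize-exists {N} {suc n} _ sol with least (λ i → solution? N (suc i)) {n} sol
    ... | m , solₘ , below = suc m , s≤s z≤n , solₘ , λ { (suc i) _ (s≤s i<m) → below i<m }

    minimalSize⇒order : ∀ {N h} → IsMonomialMinimalSize N k h → Σ Sign (ProjectiveOrder N h)
    minimalSize⇒order {N} {h} (1≤h , sol , below) = proj₁ x , record
      { positive = 1≤h
      ; power = proj₂ x
      ; minimal = λ 1≤i i<h y → below _ 1≤i i<h (ξ^[]⇒solution y)
      }
      where
      x : Σ Sign (ξ^[ h ]≡_⟨mod N ⟩)
      x = solution⇒ξ^[] sol

    first-antipode<order : ∀ {n T h} → 3 ≤ n → 1 ≤ h → ξ^[ h ]≡ Sign.+ ⟨mod n ⟩ → ξ^[ T ]≡ Sign.- ⟨mod n ⟩ →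
                           (∀ {i} → i < T → ¬ ξ^[ i ]≡ Sign.- ⟨mod n ⟩) → T < h
    first-antipode<order {n} {T} {h} n≥3 1≤h x₊ x₋ first = by-comparison (ℕP.<-cmp T h)
      where
      by-comparison : Tri (T < h) (T ≡ h) (h < T) → T < h
      by-comparison (tri< T<h _ _) = T<h
      by-comparison (tri≈ _ refl _) = contradiction (ξ^[]-sign-unique n≥3 x₋ x₊) λ ()
      by-comparison (tri> _ _ h<T) = contradiction (ξ^[]-∸ x₋′ x₊) (first o<T)
        where
        o : ℕ
        o = proj₁ (ℕP.m≤n⇒∃[o]m+o≡n h<T)
        T≡ : h ℕ.+ suc o ≡ T
        T≡ = trans (ℕP.+-suc h o) (proj₂ (ℕP.m≤n⇒∃[o]m+o≡n h<T))
        x₋′ : ξ^[ h ℕ.+ suc o ]≡ Sign.- ⟨mod n ⟩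
        x₋′ = subst (ξ^[_]≡ Sign.- ⟨mod n ⟩) (sym T≡) x₋
        o<T : suc o < T
        o<T = subst (suc o <_) T≡ (ℕP.+-monoˡ-< (suc o) 1≤h)

    palindrome-solution : ∀ {N j} → U (suc j) ≡ 1ℤ ⟨mod N ⟩ → Solution N (U j ∷ replicate j k ++ [ U j ])
    palindrome-solution {N} {j} P≡1 = subst (_≡±Id⟨mod N ⟩) (sym shape)
      (inj₂ (≡⟨mod⟩⇒≡[mod] e₁₁ , ≡⟨mod⟩⇒≡[mod] e₁₂ , ≡⟨mod⟩⇒≡[mod] e₂₁ , ≡⟨mod⟩⇒≡[mod] e₂₂))
      where
      open mod-Reasoning N
      α β P : ℤ
      α = U j
      β = proj₂ (ξ ^ j)
      P = U (suc j)
      shape : M (α ∷ replicate j k ++ [ α ]) ≡ (Mk α · mat P (- α) α β) · Mk α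
      shape = cong (_· Mk α) (trans (M-snoc (replicate j k) α) (cong (Mk α ·_) (M-replicate j)))
      P-1≡0 : P - 1ℤ ≡ 0ℤ ⟨mod N ⟩
      P-1≡0 = mod-⇒≡0 P≡1
      unit-norm : α * α + β * P - 1ℤ ≡ 0ℤ
      unit-norm = trans (expand α β k) (cong (_- 1ℤ) (norm-ξ^ j))
        where
        expand : ∀ α β k → α * α + β * (1ℤ * α * k + 1ℤ * β + 0ℤ * α) - 1ℤ ≡ α * α + α * β * k + β * β - 1ℤ
        expand = solve-∀
      e₁₁ : (α * P + - 1ℤ * α) * α + (α * - α + - 1ℤ * β) * 1ℤ ≡ - 1ℤ ⟨mod N ⟩
      e₁₁ = begin
        (α * P + - 1ℤ * α) * α + (α * - α + - 1ℤ * β) * 1ℤ    ≡⟨ entry α β P ⟩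
        - 1ℤ + (α * α + β) * (P - 1ℤ) - (α * α + β * P - 1ℤ)  ≈⟨ mod-- (mod-+ (mod-refl {x = - 1ℤ}) (mod-*ˡ (α * α + β) P-1≡0))
                                                                        (mod-reflexive unit-norm) ⟩
        - 1ℤ + (α * α + β) * 0ℤ - 0ℤ                          ≡⟨ vanish (α * α + β) ⟩
        - 1ℤ                                                  ∎
        where
        entry : ∀ α β P → (α * P + - 1ℤ * α) * α + (α * - α + - 1ℤ * β) * 1ℤ
                            ≡ - 1ℤ + (α * α + β) * (P - 1ℤ) - (α * α + β * P - 1ℤ)
        entry = solve-∀
        vanish : ∀ x → - 1ℤ + x * 0ℤ - 0ℤ ≡ - 1ℤ
        vanish = solve-∀
      e₁₂ : (α * P + - 1ℤ * α) * - 1ℤ + (α * - α + - 1ℤ * β) * 0ℤ ≡ 0ℤ ⟨mod N ⟩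
      e₁₂ = begin
        (α * P + - 1ℤ * α) * - 1ℤ + (α * - α + - 1ℤ * β) * 0ℤ  ≡⟨ entry α β P ⟩
        - α * (P - 1ℤ)                                       ≈⟨ mod-*ˡ (- α) P-1≡0 ⟩
        - α * 0ℤ                                             ≡⟨ ℤP.*-zeroʳ (- α) ⟩
        0ℤ                                                   ∎
        where
        entry : ∀ α β P → (α * P + - 1ℤ * α) * - 1ℤ + (α * - α + - 1ℤ * β) * 0ℤ ≡ - α * (P - 1ℤ)
        entry = solve-∀
      e₂₁ : (1ℤ * P + 0ℤ * α) * α + (1ℤ * - α + 0ℤ * β) * 1ℤ ≡ 0ℤ ⟨mod N ⟩
      e₂₁ = begin
        (1ℤ * P + 0ℤ * α) * α + (1ℤ * - α + 0ℤ * β) * 1ℤ  ≡⟨ entry α β P ⟩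
        α * (P - 1ℤ)                                     ≈⟨ mod-*ˡ α P-1≡0 ⟩
        α * 0ℤ                                           ≡⟨ ℤP.*-zeroʳ α ⟩
        0ℤ                                               ∎
        where
        entry : ∀ α β P → (1ℤ * P + 0ℤ * α) * α + (1ℤ * - α + 0ℤ * β) * 1ℤ ≡ α * (P - 1ℤ)
        entry = solve-∀
      e₂₂ : (1ℤ * P + 0ℤ * α) * - 1ℤ + (1ℤ * - α + 0ℤ * β) * 0ℤ ≡ - 1ℤ ⟨mod N ⟩
      e₂₂ = begin
        (1ℤ * P + 0ℤ * α) * - 1ℤ + (1ℤ * - α + 0ℤ * β) * 0ℤ  ≡⟨ entry α β P ⟩
        - 1ℤ - (P - 1ℤ)                                     ≈⟨ mod-- (mod-refl {x = - 1ℤ}) P-1≡0 ⟩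
        - 1ℤ - 0ℤ                                           ∎
        where
        entry : ∀ α β P → (1ℤ * P + 0ℤ * α) * - 1ℤ + (1ℤ * - α + 0ℤ * β) * 0ℤ ≡ - 1ℤ - (P - 1ℤ)
        entry = solve-∀

    U≡1⇒reducible : ∀ {N h j} → 1 ≤ j → 3 ℕ.+ j ≤ h → Solution N (replicate h k) → U (suc j) ≡ 1ℤ ⟨mod N ⟩ →
                    Reducible N (replicate h k)
    U≡1⇒reducible {N} {h} {j} 1≤j bound sol P≡1 =
      sol , length≥3 , A , B , length-A , length-B , palindrome-solution {N} {j} P≡1 , 0 , inj₁ A⊕B≈
      where
      r : ℕ
      r = proj₁ (ℕP.m≤n⇒∃[o]m+o≡n bound)
      h≡ : 3 ℕ.+ j ℕ.+ r ≡ h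
      h≡ = proj₂ (ℕP.m≤n⇒∃[o]m+o≡n bound)
      α : ℤ
      α = U j
      A B E : List ℤ
      A = (k - α) ∷ replicate (suc r) k ++ [ k - α ]
      B = α ∷ replicate j k ++ [ α ]
      E = (k - α + α) ∷ replicate (suc r) k ++ ((k - α + α) ∷ replicate j k)
      length≥3 : 3 ≤ length (replicate h k)
      length≥3 = subst (3 ≤_) (sym (Listₚ.length-replicate h))
                       (ℕP.≤-trans (ℕP.m≤m+n 3 j) (subst (3 ℕ.+ j ≤_) h≡ (ℕP.m≤m+n _ r)))
      length-A : 3 ≤ length A
      length-A = subst (3 ≤_) (sym (trans (length-snoc (k - α) (replicate (suc r) k) (k - α))
                                          (cong (λ n → suc (suc n)) (Listₚ.length-replicate (suc r)))))
                       (s≤s (s≤s (s≤s z≤n)))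
      length-B : 3 ≤ length B
      length-B = subst (3 ≤_) (sym (trans (length-snoc α (replicate j k) α)
                                          (cong (λ n → suc (suc n)) (Listₚ.length-replicate j)))) (s≤s (s≤s 1≤j))
      A⊕B≡E : A ⊕ B ≡ E
      A⊕B≡E rewrite lst-snoc α (replicate j k) α | middle-snoc (k - α) (replicate (suc r) k) (k - α)
                  | lst-snoc (k - α) (replicate (suc r) k) (k - α) | middle-snoc α (replicate j k) α = refl
      E-entries : All (_≡ k ⟨mod N ⟩) E
      E-entries = y≡k All.∷ Allₚ.++⁺ (Allₚ.replicate⁺ (suc r) mod-refl) (y≡k All.∷ Allₚ.replicate⁺ j mod-refl)
        where
        y≡k : k - α + α ≡ k ⟨mod N ⟩
        y≡k = mod-reflexive (cancel k α)
          where
          cancel : ∀ k α → k - α + α ≡ k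
          cancel = solve-∀
      length-E : length E ≡ h
      length-E = trans (cong suc (trans (Listₚ.length-++ (replicate (suc r) k))
                                        (cong₂ ℕ._+_ (Listₚ.length-replicate (suc r))
                                                     (cong suc (Listₚ.length-replicate j)))))
                       (trans (count r j) h≡)
        where
        count : ∀ r j → suc (suc r ℕ.+ suc j) ≡ 3 ℕ.+ j ℕ.+ r
        count = ℕS.solve-∀
      A⊕B≈ : (A ⊕ B) ≈[ N ] rotate 0 (replicate h k)
      A⊕B≈ = subst₂ _≈[ N ]_ (sym A⊕B≡E)
                    (trans (cong (λ n → replicate n k) length-E) (sym (Listₚ.++-identityʳ _)))
                    (All≡⇒≈replicate E E-entries)

    decomposition⇒U≡±1 : ∀ {N h A B} → 3 ≤ length A → 3 ≤ length B → Solution N B →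
                         Equiv N (replicate h k) (A ⊕ B) →
                         ∃ λ j → 1 ≤ j × 3 ℕ.+ j ≤ h × Σ Sign λ δ → U (suc j) ≡ ⟦ δ ⟧ ⟨mod N ⟩
    decomposition⇒U≡±1 {N} {h} {A} {B} 3≤A 3≤B solB equiv = j , 1≤j , bound , δ , U≡δ
      where
      j : ℕ
      j = length (middle B)
      B≡ : B ≡ hd B ∷ middle B ++ [ lst B ]
      B≡ = hd∷middle∷lst B (ℕP.≤-trans (ℕP.n≤1+n 2) 3≤B)
      1≤j : 1 ≤ j
      1≤j = 1≤length-middle B 3≤B
      entries : All (_≡ k ⟨mod N ⟩) (A ⊕ B)
      entries = proj₁ (Equiv-replicate⇒All equiv)
      bound : 3 ℕ.+ j ≤ h
      bound = subst (3 ℕ.+ j ≤_)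
                    (trans (cong suc (sym (Listₚ.length-++ (middle A)))) (proj₂ (Equiv-replicate⇒All equiv)))
                    (s≤s (ℕP.+-monoˡ-≤ (suc j) (1≤length-middle A 3≤A)))
      middle-B≈ : middle B ≈[ N ] replicate j k
      middle-B≈ = All≡⇒≈replicate (middle B) (All.tail (Allₚ.++⁻ʳ (middle A) (All.tail entries)))
      corner : Σ Sign λ s → Mat.m22 (M (hd B ∷ middle B ++ [ lst B ])) ≡ ⟦ s ⟧ ⟨mod N ⟩
      corner = ≡±Id⇒m₂₂ (M (hd B ∷ middle B ++ [ lst B ])) (subst (Solution N) B≡ solB)
      δ : Sign
      δ = Sign.- Sign.* proj₁ corner
      U≡δ : U (suc j) ≡ ⟦ δ ⟧ ⟨mod N ⟩
      U≡δ = begin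
        U (suc j)                                      ≡⟨ cong Mat.m11 (M-replicate j) ⟨
        Mat.m11 (M (replicate j k))                    ≈⟨ mod-sym (_≈ᴹ_⟨mod_⟩.≈₁₁ (M-cong-mod middle-B≈)) ⟩
        Mat.m11 (M (middle B))                         ≡⟨ ℤP.neg-involutive _ ⟨
        - - Mat.m11 (M (middle B))                     ≡⟨ cong -_ (M-bracket-m₂₂ (hd B) (middle B) (lst B)) ⟨
        - Mat.m22 (M (hd B ∷ middle B ++ [ lst B ]))   ≈⟨ mod-neg (proj₂ corner) ⟩
        - ⟦ proj₁ corner ⟧                             ≡⟨ ⟦⟧-opposite (proj₁ corner) ⟩
        ⟦ δ ⟧                                          ∎
        where open mod-Reasoning N

  -- The modulus N = 4pᵐ

  -- q = p ^ suc m is the paper's pᵐ with m ≥ 1.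
  module FourTimesOddPrimePower (p : ℕ) (pr : Prime p) (p≥3 : 3 ≤ p) (m : ℕ) (a : ℤ)
                                (a-odd : ¬ + 2 Unsigned.∣ a) (p∤a : ¬ + p Unsigned.∣ a) where

    k : ℤ
    k = + 2 * a

    q N : ℕ
    q = p ℕ.^ suc m
    N = 4 ℕ.* q

    open QuadraticAlgebra k

    instance
      p≢0 : ℕ.NonZero p
      p≢0 = ℕ.>-nonZero (ℕP.≤-trans (s≤s z≤n) p≥3)

    p∣q : p ℕD.∣ q
    p∣q = ℕD.m∣m*n (p ℕ.^ m)

    q≥3 : 3 ≤ q
    q≥3 = ℕP.≤-trans p≥3 (ℕD.∣⇒≤ {{ℕP.m^n≢0 p (suc m)}} p∣q)

    4∣N : 4 ℕD.∣ N
    4∣N = ℕD.m∣m*n q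

    q∣N : q ℕD.∣ N
    q∣N = ℕD.n∣m*n 4

    4⊥q : Coprime 4 q
    4⊥q = coprime-^ʳ (suc m) (Cop.sym (coprime-^ʳ 2 (prime⇒coprime pr p≥3)))

    k≡2⟨mod4⟩ : k ≡ + 2 ⟨mod 4 ⟩
    k≡2⟨mod4⟩ with a ℤ.% + 2 | ℤDM.a≡a%n+[a/n]*n a (+ 2) | ℤDM.n%d<d a (+ 2)
    ... | 0 | a≡ | _ = contradiction (∣⇒∣ᵤ (divides (a ℤ./ + 2) (trans a≡ (ℤP.+-identityˡ _)))) a-odd
    ... | 1 | a≡ | _ = mod-via (divides (a ℤ./ + 2) (trans (cong (λ z → + 2 * z - + 2) a≡) (halve (a ℤ./ + 2)))) refl
      where
      halve : ∀ t → + 2 * (1ℤ + t * + 2) - + 2 ≡ t * + 4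
      halve = solve-∀
    ... | suc (suc _) | _ | s≤s (s≤s ())

    k≢0⟨modp⟩ : ¬ k ≡ 0ℤ ⟨mod p ⟩
    k≢0⟨modp⟩ k≡0 = Sum.[ 2≢0 , p∤a ∘ mod-≡0⇒∣ ]′ (mod-euclid pr k≡0)
      where
      2≢0 : ¬ + 2 ≡ 0ℤ ⟨mod p ⟩
      2≢0 2≡0 = ℕP.<-irrefl refl (ℕP.≤-trans p≥3 (ℕD.∣⇒≤ (mod-≡0⇒∣ 2≡0)))

    solution-N⇒ : ∀ {i} → Solution N (replicate i k) → 4 ℕD.∣ i × ξ^[ i ]≡ Sign.+ ⟨mod q ⟩
    solution-N⇒ {i} sol = proj₁ mod4 , ξ^[]-∣ q∣N (subst (ξ^[ i ]≡_⟨mod N ⟩) (proj₂ mod4) (proj₂ x))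
      where
      x : Σ Sign (ξ^[ i ]≡_⟨mod N ⟩)
      x = solution⇒ξ^[] sol
      mod4 : 4 ℕD.∣ i × proj₁ x ≡ Sign.+
      mod4 = ξ^[]⟨mod4⟩ k≡2⟨mod4⟩ (ξ^[]-∣ 4∣N (proj₂ x))

    ⇒solution-N : ∀ {i} → 4 ℕD.∣ i → ξ^[ i ]≡ Sign.+ ⟨mod q ⟩ → Solution N (replicate i k)
    ⇒solution-N 4∣i x = ξ^[]⇒solution (ξ^[]-crt 4⊥q (4∣⇒ξ^[]≡+⟨mod4⟩ k≡2⟨mod4⟩ 4∣i) x)

    ¬ξ^[2mod4]≡- : ∀ {h s₀ i} → ¬ 2 ℕD.∣ h ⊎ 4 ℕD.∣ h → ProjectiveOrder p h s₀ →
                   4 ℕD.∣ 2 ℕ.+ i → ¬ ξ^[ i ]≡ Sign.- ⟨mod q ⟩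
    ¬ξ^[2mod4]≡- {h} {s₀} {i} shape ord 4∣2+i x = Sum.[ odd-order , 4∣order ]′ shape
      where
      exponent : ∃ λ r → i ≡ r ℕ.* h × Sign.- ≡ s₀ ^ˢ r
      exponent = period p≥3 ord (ξ^[]-∣ p∣q x)
      r : ℕ
      r = proj₁ exponent
      i≡rh : i ≡ r ℕ.* h
      i≡rh = proj₁ (proj₂ exponent)
      odd-order : ¬ ¬ 2 ℕD.∣ h
      odd-order 2∤h = Sum.[ even-exponent , 2∤h ]′ (euclidsLemma r h prime[2] 2∣rh)
        where
        2∣rh : 2 ℕD.∣ r ℕ.* h
        2∣rh = subst (2 ℕD.∣_) i≡rh (ℕD.∣m+n∣m⇒∣n (ℕD.∣-trans (divides 2 refl) 4∣2+i) ℕD.∣-refl)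
        even-exponent : ¬ 2 ℕD.∣ r
        even-exponent (divides t r≡t*2) =
          contradiction (trans (proj₂ (proj₂ exponent)) (trans (cong (s₀ ^ˢ_) r≡t*2) (^ˢ-even s₀ t))) λ ()
      4∣order : ¬ 4 ℕD.∣ h
      4∣order 4∣h = 4∤2 (ℕD.∣m+n∣m⇒∣n 4∣rh+2 (ℕD.∣n⇒∣m*n r 4∣h))
        where
        4∣rh+2 : 4 ℕD.∣ r ℕ.* h ℕ.+ 2
        4∣rh+2 = subst (4 ℕD.∣_) (trans (cong (2 ℕ.+_) i≡rh) (ℕP.+-comm 2 (r ℕ.* h))) 4∣2+i

    U≢±1 : ∀ {h s₀ h′} → ¬ 2 ℕD.∣ h ⊎ 4 ℕD.∣ h → ProjectiveOrder p h s₀ → IsMonomialMinimalSize N k h′ →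
           ∀ {j δ} → 1 ≤ j → 3 ℕ.+ j ≤ h′ → ¬ U (suc j) ≡ ⟦ δ ⟧ ⟨mod N ⟩
    U≢±1 {h′ = h′} shape ord (_ , _ , below) {j} {δ} 1≤j 2+j<h′ U≡δ =
      by-sign δ (mod-trans (mod-sym (U≡n⟨mod4⟩ k≡2⟨mod4⟩ (suc j))) (mod-∣ 4∣N U≡δ))
                (U≡±1-dichotomy {p} {suc m} pr k≢0⟨modp⟩ (mod-∣ q∣N U≡δ))
      where
      j<h′ : j < h′
      j<h′ = ℕP.≤-trans (ℕP.n≤1+n (suc j)) (ℕP.<⇒≤ 2+j<h′)
      by-sign : ∀ δ → + suc j ≡ ⟦ δ ⟧ ⟨mod 4 ⟩ →
                ξ^[ j ]≡ δ ⟨mod q ⟩ ⊎ ξ^[ 2 ℕ.+ j ]≡ Sign.- Sign.* δ ⟨mod q ⟩ → ⊥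
      by-sign Sign.+ j+1≡1 = Sum.[ (λ x → below j 1≤j j<h′ (⇒solution-N 4∣j x)) ,
                                   ¬ξ^[2mod4]≡- shape ord (ℕD.∣m∣n⇒∣m+n (ℕD.∣-refl {4}) 4∣j) ]′
        where
        4∣j : 4 ℕD.∣ j
        4∣j = mod-≡0⇒∣ (mod-⇒≡0 j+1≡1)
      by-sign Sign.- j+1≡-1 = Sum.[ ¬ξ^[2mod4]≡- shape ord 4∣2+j ,
                                    (λ x → below (2 ℕ.+ j) (s≤s z≤n) 2+j<h′ (⇒solution-N 4∣2+j x)) ]′
        where
        4∣2+j : 4 ℕD.∣ 2 ℕ.+ j
        4∣2+j = subst (4 ℕD.∣_) (ℕP.+-comm (suc j) 1) (mod-≡0⇒∣ (mod-⇒≡0 j+1≡-1))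

    ξ^[2]≢- : ¬ ξ^[ 2 ]≡ Sign.- ⟨mod q ⟩
    ξ^[2]≢- (power≡ (U₂≡0 & _)) =
      k≢0⟨modp⟩ (mod-∣ p∣q (mod-trans (mod-reflexive (sym (cong proj₁ ξ²≡))) U₂≡0))

    antipodal⇒U≡1 : ∀ {j} → 4 ℕD.∣ j → ξ^[ 2 ℕ.+ j ]≡ Sign.- ⟨mod q ⟩ → U (suc j) ≡ 1ℤ ⟨mod N ⟩
    antipodal⇒U≡1 {j} 4∣j (power≡ (_ & β≡-1)) = mod-crt 4⊥q U≡1⟨mod4⟩ U≡1⟨modq⟩
      where
      U≡1⟨mod4⟩ : U (suc j) ≡ 1ℤ ⟨mod 4 ⟩
      U≡1⟨mod4⟩ = mod-trans (U≡n⟨mod4⟩ k≡2⟨mod4⟩ (suc j)) (mod-≡0⇒ (∣⇒mod-≡0 4∣j))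
      U≡1⟨modq⟩ : U (suc j) ≡ 1ℤ ⟨mod q ⟩
      U≡1⟨modq⟩ = subst₂ _≡_⟨mod q ⟩ (ℤP.neg-involutive _) refl
                    (mod-neg (mod-trans (mod-reflexive (sym (cong proj₂ (ξ-⊗ (U (suc j)) (proj₂ (ξ ^ suc j)))))) β≡-1))

    -- The least T with ξ^T ≡ −1 mod q lies below h′ and is an odd multiple of h ≡ 2 mod 4.
    U≡1-witness : ∀ {u s₀ h′} → ProjectiveOrder p (2 ℕ.+ u ℕ.* 4) s₀ → IsMonomialMinimalSize N k h′ →
                  ∃ λ j → 1 ≤ j × 3 ℕ.+ j ≤ h′ × U (suc j) ≡ 1ℤ ⟨mod N ⟩
    U≡1-witness {u} {s₀} {h′} ord (1≤h′ , solh′ , _) = by-quotient w T≡2+4w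
      where
      open ProjectiveOrder ord
      h : ℕ
      h = 2 ℕ.+ u ℕ.* 4
      c : ℕ
      c = suc (u ℕ.* 2)
      s₀≡- : s₀ ≡ Sign.-
      s₀≡- = even-order⇒antipodal pr (odd-prime∤8 pr p≥3) (s≤s z≤n)
               (subst (λ n → ProjectiveOrder p n s₀) (double u) ord)
        where
        double : ∀ u → 2 ℕ.+ u ℕ.* 4 ≡ suc (u ℕ.* 2) ℕ.+ suc (u ℕ.* 2)
        double = ℕS.solve-∀
      lifted : ξ^[ p ℕ.^ m ℕ.* h ]≡ Sign.- ⟨mod q ⟩
      lifted = ξ^[]-lift-pow (^ˢ-odd-prime pr p≥3 Sign.-) (subst (ξ^[ h ]≡_⟨mod p ⟩) s₀≡- power) m
      first : ∃ λ T → ξ^[ T ]≡ Sign.- ⟨mod q ⟩ × ∀ {i} → i < T → ¬ ξ^[ i ]≡ Sign.- ⟨mod q ⟩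
      first = least (ξ^[_]≟ Sign.- ⟨mod q ⟩) lifted
      T : ℕ
      T = proj₁ first
      T<h′ : T < h′
      T<h′ = first-antipode<order q≥3 1≤h′ (proj₂ (solution-N⇒ solh′)) (proj₁ (proj₂ first)) (proj₂ (proj₂ first))
      exponent : ∃ λ r → T ≡ r ℕ.* h × Sign.- ≡ s₀ ^ˢ r
      exponent = period p≥3 ord (ξ^[]-∣ p∣q (proj₁ (proj₂ first)))
      t : ℕ
      t = proj₁ (^ˢ-odd⁻¹ (proj₁ exponent) (trans (proj₂ (proj₂ exponent)) (cong (_^ˢ proj₁ exponent) s₀≡-)))
      w : ℕ
      w = u ℕ.+ t ℕ.+ t ℕ.* u ℕ.* 2
      T≡2+4w : T ≡ 2 ℕ.+ w ℕ.* 4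
      T≡2+4w = trans (proj₁ (proj₂ exponent))
                 (trans (cong (ℕ._* h) (proj₂ (^ˢ-odd⁻¹ (proj₁ exponent) _))) (expand u t))
        where
        expand : ∀ u t → suc (t ℕ.* 2) ℕ.* (2 ℕ.+ u ℕ.* 4) ≡ 2 ℕ.+ (u ℕ.+ t ℕ.+ t ℕ.* u ℕ.* 2) ℕ.* 4
        expand = ℕS.solve-∀
      by-quotient : ∀ v → T ≡ 2 ℕ.+ v ℕ.* 4 → ∃ λ j → 1 ≤ j × 3 ℕ.+ j ≤ h′ × U (suc j) ≡ 1ℤ ⟨mod N ⟩
      by-quotient zero T≡2 = contradiction (subst (ξ^[_]≡ Sign.- ⟨mod q ⟩) T≡2 (proj₁ (proj₂ first))) ξ^[2]≢-
      by-quotient (suc v) T≡ = suc v ℕ.* 4 , s≤s z≤n , subst (_< h′) T≡ T<h′ ,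
        antipodal⇒U≡1 (divides (suc v) refl) (subst (ξ^[_]≡ Sign.- ⟨mod q ⟩) T≡ (proj₁ (proj₂ first)))

    minimalSize-N-exists : ∀ {h} → IsMonomialMinimalSize p k h → ∃ (IsMonomialMinimalSize N k)
    minimalSize-N-exists {h} Hp = minimalSize-exists 1≤4n (⇒solution-N (ℕD.m∣m*n n) ξ^4n≡+)
      where
      s₀ : Sign
      s₀ = proj₁ (minimalSize⇒order Hp)
      open ProjectiveOrder (proj₂ (minimalSize⇒order Hp))
      n : ℕ
      n = p ℕ.^ m ℕ.* h
      ξ^4n≡+ : ξ^[ 4 ℕ.* n ]≡ Sign.+ ⟨mod q ⟩
      ξ^4n≡+ = subst (ξ^[ 4 ℕ.* n ]≡_⟨mod q ⟩) (^ˢ-even s₀ 2)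
                 (ξ^[]-* 4 (ξ^[]-lift-pow (^ˢ-odd-prime pr p≥3 s₀) power m))
      1≤4n : 1 ≤ 4 ℕ.* n
      1≤4n = ℕP.≤-trans (ℕP.*-mono-≤ (ℕP.m^n>0 p m) positive) (ℕP.m≤n*m n 4)

    minimalSize-p-exists : ∀ {h′} → IsMonomialMinimalSize N k h′ → ∃ (IsMonomialMinimalSize p k)
    minimalSize-p-exists {h′} (1≤h′ , sol , _) =
      minimalSize-exists 1≤h′ (ξ^[]⇒solution (ξ^[]-∣ p∣q (proj₂ (solution-N⇒ {h′} sol))))

    classification : ∀ {h h′} → IsMonomialMinimalSize p k h → IsMonomialMinimalSize N k h′ →
      (h ℕ.% 4 ≡ 2 → Reducible N (replicate h′ k)) ×
      (h ℕ.% 4 ≡ 3 ⊎ h ℕ.% 4 ≡ 0 ⊎ h ℕ.% 4 ≡ 1 → Irreducible N (replicate h′ k))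
    classification {h} {h′} Hp HN@(1≤h′ , sol , _) = reducible , irreducible
      where
      s₀ : Sign
      s₀ = proj₁ (minimalSize⇒order Hp)
      ord : ProjectiveOrder p h s₀
      ord = proj₂ (minimalSize⇒order Hp)
      reducible : h ℕ.% 4 ≡ 2 → Reducible N (replicate h′ k)
      reducible h≡2 =
        let (j , 1≤j , bound , U≡1) =
              U≡1-witness {h ℕ./ 4} (subst (λ n → ProjectiveOrder p n s₀) (residue≡2⇒ h h≡2) ord) HN
        in U≡1⇒reducible 1≤j bound sol U≡1
      length≥3 : 3 ≤ length (replicate h′ k)
      length≥3 = subst (3 ≤_) (sym (Listₚ.length-replicate h′))
                   (ℕP.≤-trans (ℕP.n≤1+n 3) (ℕD.∣⇒≤ {{ℕ.>-nonZero 1≤h′}} (proj₁ (solution-N⇒ {h′} sol))))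
      irreducible : h ℕ.% 4 ≡ 3 ⊎ h ℕ.% 4 ≡ 0 ⊎ h ℕ.% 4 ≡ 1 → Irreducible N (replicate h′ k)
      irreducible residue = sol , length≥3 , λ (A , B , 3≤A , 3≤B , solB , equiv) →
        let (j , 1≤j , bound , δ , U≡δ) = decomposition⇒U≡±1 {N} {h′} {A} {B} 3≤A 3≤B solB equiv
        in U≢±1 (residue≢2⇒odd⊎4∣ h residue) ord HN {j} {δ} 1≤j bound U≡δ

open import Defs
open import Data.Nat using (ℕ; _≤_; _*_; _^_; _%_)
open import Data.Nat.Primality using (Prime)
open import Data.Integer as ℤ using (ℤ; +_)
open import Data.Integer.Divisibility using (_∣_)
open import Data.List using (replicate)
open import Data.Product using (_×_)
open import Data.Sum using (_⊎_)
open import Function.Bundles using (_⇔_)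
open import Relation.Nullary using (¬_)
open import Relation.Binary.PropositionalEquality using (_≡_; _≢_)
open import Data.Nat using (zero; suc)
open import Data.Product using (_,_; proj₁; proj₂)
open import Function.Bundles using (mk⇔)
open MonomialSolutions

proposition5p4 : (p : ℕ) → Prime p → p ≢ 2 → (m : ℕ) → 1 ≤ m →
    (∀ (a : ℤ) → ¬ ((+ 2) ∣ a) → ¬ ((+ p) ∣ a) → ∀ (h h' : ℕ) →
      IsMonomialMinimalSize p (+ 2 ℤ.* a) h →
      IsMonomialMinimalSize (4 * p ^ m) (+ 2 ℤ.* a) h' →
      ((h % 4 ≡ 2 → Reducible (4 * p ^ m) (replicate h' (+ 2 ℤ.* a)))
       × ((h % 4 ≡ 3 ⊎ h % 4 ≡ 0 ⊎ h % 4 ≡ 1) →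
          Irreducible (4 * p ^ m) (replicate h' (+ 2 ℤ.* a)))))
    × (SemiMonomiallyIrreducible (4 * p ^ m) ⇔
       (∀ (a : ℤ) → ¬ ((+ 2) ∣ a) → ¬ ((+ p) ∣ a) → ∀ (h : ℕ) →
          IsMonomialMinimalSize p (+ 2 ℤ.* a) h → h % 4 ≢ 2))
proposition5p4 p pr p≢2 zero ()
proposition5p4 p pr p≢2 (suc m) _ = (λ a a-odd p∤a _ _ → classification a a-odd p∤a) , mk⇔ ⇒ ⇐
  where
  open FourTimesOddPrimePower p pr (odd-prime≥3 pr p≢2) m
    using (classification; minimalSize-N-exists; minimalSize-p-exists)
  ⇒ : SemiMonomiallyIrreducible (4 * p ^ suc m) →
      ∀ a → ¬ + 2 ∣ a → ¬ + p ∣ a → ∀ h → IsMonomialMinimalSize p (+ 2 ℤ.* a) h → h % 4 ≢ 2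
  ⇒ irreducible a a-odd p∤a h Hp h%4≡2 =
    let (h′ , HN) = minimalSize-N-exists a a-odd p∤a Hp
    in reducible⇒¬irreducible (proj₁ (classification a a-odd p∤a Hp HN) h%4≡2)
                              (irreducible a (coprime-4pᵐ {p} {a} (suc m) pr a-odd p∤a) h′ HN)
  ⇐ : (∀ a → ¬ + 2 ∣ a → ¬ + p ∣ a → ∀ h → IsMonomialMinimalSize p (+ 2 ℤ.* a) h → h % 4 ≢ 2) →
      SemiMonomiallyIrreducible (4 * p ^ suc m)
  ⇐ residue≢2 a a⊥N h′ HN =
    let (a-odd , p∤a) = coprime-4pᵐ⁻¹ {p} {a} m (odd-prime≥3 pr p≢2) a⊥N
        (h , Hp) = minimalSize-p-exists a a-odd p∤a HN
    in proj₂ (classification a a-odd p∤a Hp HN) (residue≢2-cases h (residue≢2 a a-odd p∤a h Hp))
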